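{- Let $\beta$ be a Salem number with minimal polynomial $P(x) = x^6 + ax^5 + bx^4 + cx^3 + bx^2 + ax + 1$, where $a,b,c\in\mathbb{Z}$. Then $\beta \in P_{1,7} \cap C_{x^2+1}$ (that is, $d_\beta(1)$ is eventually periodic with preperiod length $1$ and period length $7$, and the co-factor of $\beta$ is $x^2+1$) if and only if all of the following hold: (i) $b \leq -1$; (ii) $1 \leq c \leq -a$; (iii) $a \leq 2b$; (iv) if $a = 2b$ then $1 \leq b + c$.
   Context: A Salem number is a real algebraic integer $\beta>1$ whose other Galois conjugates all satisfy $|\alpha|\le 1$, with at least one satisfying $|\alpha|=1$. For real $\beta>1$, the greedy beta expansion $d_\beta(1)=(c_n)_{n\ge1}$ is defined by $r_0=1$, and for $n\ge 1$: $c_n=\lfloor \beta r_{n-1}\rfloor$, $r_n=\beta r_{n-1}-\lfloor \beta r_{n-1}\rfloor$. If it is eventually periodic, $\beta$ is called a Parry number, and the smallest $m\ge0$ and $p\ge1$ with $c_{n+m}=c_{n+m+p}$ for all $n\ge1$ are the preperiod length and the period length of the expansion. (By convention $p=0$ if $r_N=0$ for some $N$; this never happens for Salem numbers.) For a Salem number $\beta$ that is a Parry number with preperiod length $m$ and period length $p\geq 1$, put $P_k(x)=x^k-c_1x^{k-1}-\dots-c_k$. The companion polynomial is $R(x)=P_{m+p}(x)-P_m(x)$; it has $\beta$ as a root, so $R(x)=P(x)Q(x)$ with $P$ the minimal polynomial of $\beta$ and $Q\in\mathbb{Z}[x]$; $Q$ is the co-factor of $\beta$. $P_{m,p}$ denotes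 the set of Salem Parry numbers whose beta expansion $d_\beta(1)$ has preperiod length $m$ and period length $p$. $C_{Q(x)}$ denotes the set of all Salem (Parry) numbers whose co-factor is $Q(x)$. -}

module Defs where

open import Algebra.Bundles.Raw using (RawRing)
open import Data.Integer.Base as ℤ using (ℤ)
open import Data.List.Base using (List; []; _∷_; map; foldr)
open import Data.Nat.Base as ℕ using (ℕ; zero; suc)
import Data.Nat.Properties as ℕ
open import Data.Product.Base using (∃-syntax; _×_; _,_; proj₁; proj₂)
open import Data.Rational.Base as ℚ using (ℚ; 0ℚ; 1ℚ; ½)
import Data.Rational.Properties as ℚ
import Data.Rational.Solver as ℚ
open import Level using (0ℓ)
open import Relation.Binary.PropositionalEquality
  using (_≡_; refl; sym; cong; cong₂; subst)
open import Relation.Nullary using (¬_)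
open import Relation.Unary using (Pred)

-- Real numbers: Cauchy sequences of rationals, with the setoid equality
-- _≈_ below.  All operations act pointwise.

IsCauchy : (ℕ → ℚ) → Set
IsCauchy s = ∀ ε → 0ℚ ℚ.< ε →
  ∃[ N ] (∀ m n → N ℕ.≤ m → N ℕ.≤ n → ℚ.∣ s m ℚ.- s n ∣ ℚ.≤ ε)

record ℝ : Set where
  constructor mkℝ
  field
    seq    : ℕ → ℚ
    cauchy : IsCauchy seq

open ℝ public

infix 4 _≈_ _<_ _≤_

_≈_ : ℝ → ℝ → Set
x ≈ y = ∀ ε → 0ℚ ℚ.< ε →
  ∃[ N ] (∀ n → N ℕ.≤ n → ℚ.∣ seq x n ℚ.- seq y n ∣ ℚ.≤ ε)

_<_ : ℝ → ℝ → Set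
x < y = ∃[ ε ] (0ℚ ℚ.< ε ×
  ∃[ N ] (∀ n → N ℕ.≤ n → seq x n ℚ.+ ε ℚ.≤ seq y n))

_≤_ : ℝ → ℝ → Set
x ≤ y = ∀ ε → 0ℚ ℚ.< ε →
  ∃[ N ] (∀ n → N ℕ.≤ n → seq x n ℚ.≤ seq y n ℚ.+ ε)

private
  open ℚ.+-*-Solver using (solve; _:+_; _:*_; _:-_; :-_; _:=_)

  half-pos : ∀ {ε} → 0ℚ ℚ.< ε → 0ℚ ℚ.< ½ ℚ.* ε
  half-pos {ε} ε>0 = ℚ.positive⁻¹ (½ ℚ.* ε)
    where
    instance
      _ : ℚ.Positive ε
      _ = ℚ.positive ε>0
      _ : ℚ.Positive (½ ℚ.* ε)
      _ = ℚ.pos*pos⇒pos ½ ε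

  halves : ∀ ε → ½ ℚ.* ε ℚ.+ ½ ℚ.* ε ≡ ε
  halves ε = begin-equality
    ½ ℚ.* ε ℚ.+ ½ ℚ.* ε ≡⟨ ℚ.*-distribʳ-+ ε ½ ½ ⟨
    (½ ℚ.+ ½) ℚ.* ε     ≡⟨ ℚ.*-identityˡ ε ⟩
    ε                   ∎
    where open ℚ.≤-Reasoning

  add-cauchy : ∀ s t → IsCauchy s → IsCauchy t →
               IsCauchy (λ n → s n ℚ.+ t n)
  add-cauchy s t cs ct ε ε>0 =
    N ℕ.⊔ M , λ m n p q → begin
      ℚ.∣ (s m ℚ.+ t m) ℚ.- (s n ℚ.+ t n) ∣
        ≡⟨ cong ℚ.∣_∣ (rearrange (s m) (t m) (s n) (t n)) ⟩
      ℚ.∣ (s m ℚ.- s n) ℚ.+ (t m ℚ.- t n) ∣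
        ≤⟨ ℚ.∣p+q∣≤∣p∣+∣q∣ (s m ℚ.- s n) (t m ℚ.- t n) ⟩
      ℚ.∣ s m ℚ.- s n ∣ ℚ.+ ℚ.∣ t m ℚ.- t n ∣
        ≤⟨ ℚ.+-mono-≤ (hs m n (ℕ.m⊔n≤o⇒m≤o N M p) (ℕ.m⊔n≤o⇒m≤o N M q))
                      (ht m n (ℕ.m⊔n≤o⇒n≤o N M p) (ℕ.m⊔n≤o⇒n≤o N M q)) ⟩
      ½ ℚ.* ε ℚ.+ ½ ℚ.* ε
        ≡⟨ halves ε ⟩
      ε ∎
    where
    open ℚ.≤-Reasoning
    N = proj₁ (cs (½ ℚ.* ε) (half-pos ε>0))
    hs = proj₂ (cs (½ ℚ.* ε) (half-pos ε>0))
    M = proj₁ (ct (½ ℚ.* ε) (half-pos ε>0))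
    ht = proj₂ (ct (½ ℚ.* ε) (half-pos ε>0))
    rearrange : ∀ a b c d →
      (a ℚ.+ b) ℚ.- (c ℚ.+ d) ≡ (a ℚ.- c) ℚ.+ (b ℚ.- d)
    rearrange = solve 4
      (λ a b c d → (a :+ b) :- (c :+ d) := (a :- c) :+ (b :- d)) refl

  neg-cauchy : ∀ s → IsCauchy s → IsCauchy (λ n → ℚ.- s n)
  neg-cauchy s cs ε ε>0 =
    proj₁ (cs ε ε>0) , λ m n p q → begin
      ℚ.∣ ℚ.- s m ℚ.- ℚ.- s n ∣
        ≡⟨ cong ℚ.∣_∣ (rearrange (s m) (s n)) ⟩
      ℚ.∣ s n ℚ.- s m ∣
        ≤⟨ proj₂ (cs ε ε>0) n m q p ⟩
      ε ∎
    where
    open ℚ.≤-Reasoning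
    rearrange : ∀ a b → ℚ.- a ℚ.- ℚ.- b ≡ b ℚ.- a
    rearrange = solve 2 (λ a b → :- a :- :- b := b :- a) refl

  record EventualBound (s : ℕ → ℚ) : Set where
    field
      bound     : ℚ
      bound-pos : ℚ.Positive bound
      from      : ℕ
      bounded   : ∀ n → from ℕ.≤ n → ℚ.∣ s n ∣ ℚ.≤ bound

  eventual-bound : ∀ s → IsCauchy s → EventualBound s
  eventual-bound s cs = record
    { bound     = 1ℚ ℚ.+ ℚ.∣ s N ∣
    ; bound-pos = ℚ.pos+nonNeg⇒pos 1ℚ ℚ.∣ s N ∣ {{ℚ.∣-∣-nonNeg (s N)}}
    ; from      = N
    ; bounded   = λ n p → begin
        ℚ.∣ s n ∣
          ≡⟨ cong ℚ.∣_∣ (rearrange (s n) (s N)) ⟩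
        ℚ.∣ (s n ℚ.- s N) ℚ.+ s N ∣
          ≤⟨ ℚ.∣p+q∣≤∣p∣+∣q∣ (s n ℚ.- s N) (s N) ⟩
        ℚ.∣ s n ℚ.- s N ∣ ℚ.+ ℚ.∣ s N ∣
          ≤⟨ ℚ.+-monoˡ-≤ ℚ.∣ s N ∣ (proj₂ c₁ n N p ℕ.≤-refl) ⟩
        1ℚ ℚ.+ ℚ.∣ s N ∣ ∎
    }
    where
    open ℚ.≤-Reasoning
    c₁ = cs 1ℚ (ℚ.positive⁻¹ 1ℚ)
    N = proj₁ c₁
    rearrange : ∀ a b → a ≡ (a ℚ.- b) ℚ.+ b
    rearrange = solve 2 (λ a b → a := (a :- b) :+ b) refl

  mul-cauchy : ∀ s t → IsCauchy s → IsCauchy t →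
               IsCauchy (λ n → s n ℚ.* t n)
  mul-cauchy s t cs ct ε ε>0 =
    K , λ m n p q → begin
      ℚ.∣ s m ℚ.* t m ℚ.- s n ℚ.* t n ∣
        ≡⟨ cong ℚ.∣_∣ (rearrange (s m) (t m) (s n) (t n)) ⟩
      ℚ.∣ s m ℚ.* (t m ℚ.- t n) ℚ.+ t n ℚ.* (s m ℚ.- s n) ∣
        ≤⟨ ℚ.∣p+q∣≤∣p∣+∣q∣ (s m ℚ.* (t m ℚ.- t n)) (t n ℚ.* (s m ℚ.- s n)) ⟩
      ℚ.∣ s m ℚ.* (t m ℚ.- t n) ∣ ℚ.+ ℚ.∣ t n ℚ.* (s m ℚ.- s n) ∣
        ≡⟨ cong₂ ℚ._+_ (ℚ.∣p*q∣≡∣p∣*∣q∣ (s m) _) (ℚ.∣p*q∣≡∣p∣*∣q∣ (t n) _) ⟩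
      ℚ.∣ s m ∣ ℚ.* ℚ.∣ t m ℚ.- t n ∣ ℚ.+ ℚ.∣ t n ∣ ℚ.* ℚ.∣ s m ℚ.- s n ∣
        ≤⟨ ℚ.+-mono-≤
             (product-bound (t m ℚ.- t n)
               (S.bounded m (≤K₁ p)) (proj₂ dt m n (≤K₄ p) (≤K₄ q)))
             (product-bound (s m ℚ.- s n)
               (T.bounded n (≤K₂ q)) (proj₂ ds m n (≤K₃ p) (≤K₃ q))) ⟩
      S.bound ℚ.* δ ℚ.+ T.bound ℚ.* δ
        ≡⟨ ℚ.*-distribʳ-+ δ S.bound T.bound ⟨
      B ℚ.* δ
        ≡⟨ ℚ.*-assoc B (ℚ.1/ B) ε ⟨
      (B ℚ.* ℚ.1/ B) ℚ.* ε
        ≡⟨ cong (ℚ._* ε) (ℚ.*-inverseʳ B) ⟩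
      1ℚ ℚ.* ε
        ≡⟨ ℚ.*-identityˡ ε ⟩
      ε ∎
    where
    open ℚ.≤-Reasoning
    module S = EventualBound (eventual-bound s cs)
    module T = EventualBound (eventual-bound t ct)
    B : ℚ
    B = S.bound ℚ.+ T.bound
    instance
      pos-S : ℚ.Positive S.bound
      pos-S = S.bound-pos
      pos-T : ℚ.Positive T.bound
      pos-T = T.bound-pos
      pos-B : ℚ.Positive B
      pos-B = ℚ.pos+pos⇒pos S.bound T.bound
      nonZero-B : ℚ.NonZero B
      nonZero-B = ℚ.pos⇒nonZero B
      pos-1/B : ℚ.Positive (ℚ.1/ B)
      pos-1/B = ℚ.1/pos⇒pos B
      pos-ε : ℚ.Positive ε
      pos-ε = ℚ.positive ε>0
    δ : ℚ
    δ = ℚ.1/ B ℚ.* ε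
    δ>0 : 0ℚ ℚ.< δ
    δ>0 = ℚ.positive⁻¹ δ {{ℚ.pos*pos⇒pos (ℚ.1/ B) ε}}
    ds = cs δ δ>0
    dt = ct δ δ>0
    K₁₂ K₃₄ K : ℕ
    K₁₂ = S.from ℕ.⊔ T.from
    K₃₄ = proj₁ ds ℕ.⊔ proj₁ dt
    K = K₁₂ ℕ.⊔ K₃₄
    ≤K₁ : ∀ {n} → K ℕ.≤ n → S.from ℕ.≤ n
    ≤K₁ p = ℕ.m⊔n≤o⇒m≤o S.from T.from (ℕ.m⊔n≤o⇒m≤o K₁₂ K₃₄ p)
    ≤K₂ : ∀ {n} → K ℕ.≤ n → T.from ℕ.≤ n
    ≤K₂ p = ℕ.m⊔n≤o⇒n≤o S.from T.from (ℕ.m⊔n≤o⇒m≤o K₁₂ K₃₄ p)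
    ≤K₃ : ∀ {n} → K ℕ.≤ n → proj₁ ds ℕ.≤ n
    ≤K₃ p = ℕ.m⊔n≤o⇒m≤o (proj₁ ds) (proj₁ dt) (ℕ.m⊔n≤o⇒n≤o K₁₂ K₃₄ p)
    ≤K₄ : ∀ {n} → K ℕ.≤ n → proj₁ dt ℕ.≤ n
    ≤K₄ p = ℕ.m⊔n≤o⇒n≤o (proj₁ ds) (proj₁ dt) (ℕ.m⊔n≤o⇒n≤o K₁₂ K₃₄ p)
    product-bound : ∀ {a b} .{{_ : ℚ.Positive b}} d →
      a ℚ.≤ b → ℚ.∣ d ∣ ℚ.≤ δ → a ℚ.* ℚ.∣ d ∣ ℚ.≤ b ℚ.* δ
    product-bound {a} {b} d a≤b d≤δ = ℚ.≤-trans
      (ℚ.*-monoʳ-≤-nonNeg ℚ.∣ d ∣ {{ℚ.∣-∣-nonNeg d}} a≤b)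
      (ℚ.*-monoˡ-≤-nonNeg b {{ℚ.pos⇒nonNeg b}} d≤δ)
    rearrange : ∀ a b c d →
      a ℚ.* b ℚ.- c ℚ.* d ≡ a ℚ.* (b ℚ.- d) ℚ.+ d ℚ.* (a ℚ.- c)
    rearrange = solve 4
      (λ a b c d → a :* b :- c :* d := a :* (b :- d) :+ d :* (a :- c)) refl

  constant-cauchy : ∀ q → IsCauchy (λ _ → q)
  constant-cauchy q ε ε>0 = 0 , λ _ _ _ _ →
    subst (ℚ._≤ ε) (cong ℚ.∣_∣ (sym (ℚ.+-inverseʳ q))) (ℚ.<⇒≤ ε>0)

-- Abstract, so that normalising a real expression never unfolds these proofs.
abstract
  +-cauchy : ∀ x y → IsCauchy (λ n → seq x n ℚ.+ seq y n)
  +-cauchy x y = add-cauchy (seq x) (seq y) (cauchy x) (cauchy y)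

  *-cauchy : ∀ x y → IsCauchy (λ n → seq x n ℚ.* seq y n)
  *-cauchy x y = mul-cauchy (seq x) (seq y) (cauchy x) (cauchy y)

  -‿cauchy : ∀ x → IsCauchy (λ n → ℚ.- seq x n)
  -‿cauchy x = neg-cauchy (seq x) (cauchy x)

  fromℚ-cauchy : ∀ q → IsCauchy (λ _ → q)
  fromℚ-cauchy = constant-cauchy

infixl 6 _+_ _-_
infixl 7 _*_
infix  8 -_

_+_ : ℝ → ℝ → ℝ
x + y = mkℝ (λ n → seq x n ℚ.+ seq y n) (+-cauchy x y)

_*_ : ℝ → ℝ → ℝ
x * y = mkℝ (λ n → seq x n ℚ.* seq y n) (*-cauchy x y)

-_ : ℝ → ℝ
- x = mkℝ (λ n → ℚ.- seq x n) (-‿cauchy x)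

_-_ : ℝ → ℝ → ℝ
x - y = x + (- y)

fromℚ : ℚ → ℝ
fromℚ q = mkℝ (λ _ → q) (fromℚ-cauchy q)

ℤ⇒ℚ : ℤ → ℚ
ℤ⇒ℚ i = i ℚ./ 1

fromℤ : ℤ → ℝ
fromℤ i = fromℚ (ℤ⇒ℚ i)

0ℝ 1ℝ : ℝ
0ℝ = fromℚ 0ℚ
1ℝ = fromℚ 1ℚ

ℝ-rawRing : RawRing 0ℓ 0ℓ
ℝ-rawRing = record
  { Carrier = ℝ ; _≈_ = _≈_ ; _+_ = _+_ ; _*_ = _*_ ; -_ = -_
  ; 0# = 0ℝ ; 1# = 1ℝ }

record ℂ : Set where
  constructor _+i_
  field
    re im : ℝ

open ℂ public

infix 4 _≈ℂ_

_≈ℂ_ : ℂ → ℂ → Set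
z ≈ℂ w = re z ≈ re w × im z ≈ im w

ℂ-rawRing : RawRing 0ℓ 0ℓ
ℂ-rawRing = record
  { Carrier = ℂ
  ; _≈_ = _≈ℂ_
  ; _+_ = λ z w → (re z + re w) +i (im z + im w)
  ; _*_ = λ z w → (re z * re w - im z * im w) +i (re z * im w + im z * re w)
  ; -_  = λ z → (- re z) +i (- im z)
  ; 0#  = 0ℝ +i 0ℝ
  ; 1#  = 1ℝ +i 0ℝ
  }

ℝ⇒ℂ : ℝ → ℂ
ℝ⇒ℂ x = x +i 0ℝ

-- The square of the modulus; |z| ≤ 1 and |z| = 1 are expressed as
-- ∣ z ∣² ≤ 1 and ∣ z ∣² ≈ 1.
∣_∣² : ℂ → ℝ
∣ z ∣² = re z * re z + im z * im z

-- Polynomials over a ring R: lists of coefficients, constant term first.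
-- Trailing zeros are allowed, so polynomials are compared by _≋_.

module Polynomial (R : RawRing 0ℓ 0ℓ) where
  private module R = RawRing R

  Poly : Set
  Poly = List R.Carrier

  coeff : Poly → ℕ → R.Carrier
  coeff []      _       = R.0#
  coeff (a ∷ _) zero    = a
  coeff (_ ∷ p) (suc n) = coeff p n

  infix  4 _≋_
  infixl 6 _⊕_ _⊖_
  infixl 7 _⊗_

  _≋_ : Poly → Poly → Set
  p ≋ q = ∀ n → coeff p n R.≈ coeff q n

  _⊕_ : Poly → Poly → Poly
  []      ⊕ q       = q
  (a ∷ p) ⊕ []      = a ∷ p
  (a ∷ p) ⊕ (b ∷ q) = (a R.+ b) ∷ (p ⊕ q)

  _⊖_ : Poly → Poly → Poly
  p ⊖ q = p ⊕ map R.-_ q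

  _⊗_ : Poly → Poly → Poly
  []      ⊗ q = []
  (a ∷ p) ⊗ q = map (a R.*_) q ⊕ (R.0# ∷ p ⊗ q)

  MonicOfDegree : Poly → ℕ → Set
  MonicOfDegree p n =
    coeff p n R.≈ R.1# × (∀ k → n ℕ.< k → coeff p k R.≈ R.0#)

  module Evaluation (S : RawRing 0ℓ 0ℓ)
                    (φ : R.Carrier → RawRing.Carrier S) where
    private module S = RawRing S

    eval : Poly → S.Carrier → S.Carrier
    eval p x = foldr (λ a v → φ a S.+ x S.* v) S.0# p

open Polynomial ℤ.+-*-rawRing public
  using (_≋_; _⊖_; _⊗_) renaming (Poly to ℤ[x])
open Polynomial ℚ.+-*-rawRing public
  using () renaming (Poly to ℚ[x])

private
  module ℤ[x] = Polynomial ℤ.+-*-rawRing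
  module ℚ[x] = Polynomial ℚ.+-*-rawRing

evalℤ : ℤ[x] → ℝ → ℝ
evalℤ = ℤ[x].Evaluation.eval ℝ-rawRing fromℤ

evalℚ : ℚ[x] → ℝ → ℝ
evalℚ = ℚ[x].Evaluation.eval ℝ-rawRing fromℚ

evalℂ : ℚ[x] → ℂ → ℂ
evalℂ = ℚ[x].Evaluation.eval ℂ-rawRing (λ q → ℝ⇒ℂ (fromℚ q))

ℤ[x]⇒ℚ[x] : ℤ[x] → ℚ[x]
ℤ[x]⇒ℚ[x] = map ℤ⇒ℚ

AlgebraicInteger : Pred ℝ 0ℓ
AlgebraicInteger β =
  ∃[ p ] ∃[ n ] (ℤ[x].MonicOfDegree p n × evalℤ p β ≈ 0ℝ)

record IsMinimalPolynomial (β : ℝ) (p : ℚ[x]) : Set where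
  field
    degree : ℕ
    monic  : ℚ[x].MonicOfDegree p degree
    root   : evalℚ p β ≈ 0ℝ
    least  : ∀ q k → ℚ[x].MonicOfDegree q k → evalℚ q β ≈ 0ℝ →
             degree ℕ.≤ k

OtherConjugate : ℝ → ℂ → Set
OtherConjugate β α =
  (∃[ p ] (IsMinimalPolynomial β p × evalℂ p α ≈ℂ ℝ⇒ℂ 0ℝ)) ×
  ¬ (α ≈ℂ ℝ⇒ℂ β)

record IsSalem (β : ℝ) : Set where
  field
    algebraicInteger : AlgebraicInteger β
    1<β              : 1ℝ < β
    inUnitDisc       : ∀ α → OtherConjugate β α → ∣ α ∣² ≤ 1ℝ
    onUnitCircle     : ∃[ α ] (OtherConjugate β α × ∣ α ∣² ≈ 1ℝ)

-- A digit sequence c : ℕ → ℤ is indexed from 0, so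
-- that c n is the (n+1)-st digit.

IsFloor : ℝ → ℤ → Set
IsFloor x i = fromℤ i ≤ x × x < fromℤ (i ℤ.+ ℤ.1ℤ)

remainder : ℝ → (ℕ → ℤ) → ℕ → ℝ
remainder β c zero    = 1ℝ
remainder β c (suc n) = β * remainder β c n - fromℤ (c n)

-- c = d_β(1).  The floor is a relation because it is not computable
-- on ℝ; it determines c uniquely.
IsGreedyExpansion : ℝ → (ℕ → ℤ) → Set
IsGreedyExpansion β c = ∀ n → IsFloor (β * remainder β c n) (c n)

EventuallyPeriodic : (ℕ → ℤ) → ℕ → ℕ → Set
EventuallyPeriodic c m p = ∀ n → c (n ℕ.+ m) ≡ c (n ℕ.+ m ℕ.+ p)

-- d_β(1) = c has preperiod length m and period length p ≥ 1.  Expansions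
-- with a vanishing remainder have p = 0 by convention, whence
-- `nonterminating`.
record ParryExpansion (β : ℝ) (c : ℕ → ℤ) (m p : ℕ) : Set where
  field
    greedy         : IsGreedyExpansion β c
    nonterminating : ∀ n → ¬ (remainder β c n ≈ 0ℝ)
    p≥1            : 1 ℕ.≤ p
    periodic       : EventuallyPeriodic c m p
    least          : ∀ m′ p′ → 1 ℕ.≤ p′ → EventuallyPeriodic c m′ p′ →
                     m ℕ.≤ m′ × p ℕ.≤ p′

-- P_k(x) = x^k - c₁x^(k-1) - … - c_k
P-poly : (ℕ → ℤ) → ℕ → ℤ[x]
P-poly c zero    = ℤ.1ℤ ∷ []
P-poly c (suc k) = ℤ.- c k ∷ P-poly c k

companionPolynomial : (ℕ → ℤ) → ℕ → ℕ → ℤ[x]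
companionPolynomial c m p = P-poly c (m ℕ.+ p) ⊖ P-poly c m

P⟨_,_⟩ : ℕ → ℕ → Pred ℝ 0ℓ
P⟨ m , p ⟩ β = IsSalem β × ∃[ c ] ParryExpansion β c m p

record HasCofactor (β : ℝ) (Q : ℤ[x]) : Set where
  field
    c              : ℕ → ℤ
    m p            : ℕ
    parry          : ParryExpansion β c m p
    minPoly        : ℤ[x]
    isMinPoly      : IsMinimalPolynomial β (ℤ[x]⇒ℚ[x] minPoly)
    factorisation  : companionPolynomial c m p ≋ minPoly ⊗ Q

C⟨_⟩ : ℤ[x] → Pred ℝ 0ℓ
C⟨ Q ⟩ β = IsSalem β × HasCofactor β Q

{-# OPTIONS --safe #-}
module Submission where

-- The factorisation R(x) = P(x)(x² + 1) forces, coefficient by coefficient, the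
-- digits −a, −(1+b), −(a+c), −2b, −(a+c), −(1+b), −(1+a), −(1+a), the last seven
-- repeating.  In a greedy expansion digits are nonnegative, no digit exceeds c₁,
-- and cₙ₊₁ = c₁ implies cₙ₊₂ ≤ c₂; for these digits this gives (i)–(iv).
--
-- Conversely, under (i)–(iv) every proper shift of this sequence is
-- lexicographically smaller than the sequence itself.  Writing rₙ for the
-- remainders, P(β)(β² + 1) = 0 says r₈ = r₁.  Nonnegativity of the digits gives
-- rₙ₊₁ ≤ β rₙ, and a first difference with d_β(1) after k digits gives
-- 1 − rₙ₊ₖ < βᵏ (1 − rₙ).  Going once round the period shows x < z x with
-- z > 1, hence x > 0, both for x = rₙ and for x = 1 − rₙ; so 0 < rₙ < 1 and the
-- digits are the greedy ones.

open import Defs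
open import Data.Integer.Base using (ℤ; +_; 0ℤ; 1ℤ; -1ℤ) renaming (-_ to -ℤ_; _+_ to _+ℤ_; _*_ to _*ℤ_; _≤_ to _≤ℤ_)
open import Data.List.Base using ([]; _∷_; map)
open import Data.Product.Base using (_×_; _,_; proj₁; proj₂; ∃-syntax)
open import Function.Bundles using (_⇔_; mk⇔)
open import Relation.Binary.PropositionalEquality
  using (_≡_; _≢_; refl; sym; trans; cong; cong₂; subst; subst₂; module ≡-Reasoning)
open import Relation.Unary using (_∈_; _∩_)

open import Algebra.Bundles using (Ring)
open import Data.Empty using (⊥-elim)
import Data.Integer.Base as ℤ
import Data.Integer.Properties as ℤ
open import Data.Integer.Solver renaming (module +-*-Solver to ℤ-Solver)
open import Data.Nat.Base as ℕ using (ℕ; zero; suc)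
import Data.Nat.Coprimality as Coprime
import Data.Nat.Properties as ℕ
open import Data.Nat.Solver renaming (module +-*-Solver to ℕ-Solver)
open import Data.Rational.Base as ℚ using (ℚ; 0ℚ; 1ℚ; mkℚ)
import Data.Rational.Properties as ℚ
open import Data.Rational.Solver using (module +-*-Solver)
open import Data.Sum.Base using (_⊎_; inj₁; inj₂; [_,_]′)
open import Level using (0ℓ)
open import Relation.Nullary using (¬_; Dec; yes; no)

open +-*-Solver using (solve; _:=_; _:+_; _:*_; _:-_; :-_; con)
open ℤ-Solver using () renaming
  (solve to solveℤ; _:=_ to _:=ℤ_; _:+_ to _:+ℤ_; _:*_ to _:*ℤ_; _:-_ to _:-ℤ_; :-_ to :-ℤ_; con to conℤ)
open ℕ-Solver using () renaming
  (solve to solveℕ; _:=_ to _:=ℕ_; _:+_ to _:+ℕ_; _:*_ to _:*ℕ_; con to conℕ)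

-- Rational and real order

0≤p⇒q≤q+p : ∀ q {p} → 0ℚ ℚ.≤ p → q ℚ.≤ q ℚ.+ p
0≤p⇒q≤q+p q 0≤p = subst (ℚ._≤ q ℚ.+ _) (ℚ.+-identityʳ q) (ℚ.+-monoʳ-≤ q 0≤p)

p+r≤q⇒r≤q-p : ∀ {p q r} → p ℚ.+ r ℚ.≤ q → r ℚ.≤ q ℚ.- p
p+r≤q⇒r≤q-p {p} {q} {r} h = subst (ℚ._≤ q ℚ.- p)
  (solve 2 (λ p r → (p :+ r) :- p := r) refl p r) (ℚ.+-monoˡ-≤ (ℚ.- p) h)

r≤q-p⇒p+r≤q : ∀ {p q r} → r ℚ.≤ q ℚ.- p → p ℚ.+ r ℚ.≤ q
r≤q-p⇒p+r≤q {p} {q} {r} h = subst (p ℚ.+ r ℚ.≤_)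
  (solve 2 (λ p q → p :+ (q :- p) := q) refl p q) (ℚ.+-monoʳ-≤ p h)

p≤q+r⇒p-q≤r : ∀ {p q r} → p ℚ.≤ q ℚ.+ r → p ℚ.- q ℚ.≤ r
p≤q+r⇒p-q≤r {p} {q} {r} h = subst (p ℚ.- q ℚ.≤_)
  (solve 2 (λ q r → (q :+ r) :- q := r) refl q r) (ℚ.+-monoˡ-≤ (ℚ.- q) h)

p-q≤r⇒p≤q+r : ∀ {p q r} → p ℚ.- q ℚ.≤ r → p ℚ.≤ q ℚ.+ r
p-q≤r⇒p≤q+r {p} {q} {r} h = subst (ℚ._≤ q ℚ.+ r)
  (solve 2 (λ p q → q :+ (p :- q) := p) refl p q) (ℚ.+-monoʳ-≤ q h)

p≤∣p∣ : ∀ p → p ℚ.≤ ℚ.∣ p ∣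
p≤∣p∣ p with ℚ.≤-total 0ℚ p
... | inj₁ 0≤p = ℚ.≤-reflexive (sym (ℚ.0≤p⇒∣p∣≡p 0≤p))
... | inj₂ p≤0 = ℚ.≤-trans p≤0 (ℚ.0≤∣p∣ p)

∣p∣≤q : ∀ {p q} → p ℚ.≤ q → ℚ.- p ℚ.≤ q → ℚ.∣ p ∣ ℚ.≤ q
∣p∣≤q {p} h₁ h₂ with ℚ.∣p∣≡p∨∣p∣≡-p p
... | inj₁ e = subst (ℚ._≤ _) (sym e) h₁
... | inj₂ e = subst (ℚ._≤ _) (sym e) h₂

0<p*q : ∀ {p q} → 0ℚ ℚ.< p → 0ℚ ℚ.< q → 0ℚ ℚ.< p ℚ.* q
0<p*q {p} {q} 0<p 0<q = ℚ.positive⁻¹ (p ℚ.* q)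
  {{ℚ.pos*pos⇒pos p {{ℚ.positive 0<p}} q {{ℚ.positive 0<q}}}}

ℚ-quotient : ∀ {b p} → 0ℚ ℚ.< b → 0ℚ ℚ.< p → ∃[ q ] (0ℚ ℚ.< q × b ℚ.* q ≡ p)
ℚ-quotient {b} {p} 0<b 0<p = ℚ.1/ b ℚ.* p , 0<p*q (ℚ.positive⁻¹ (ℚ.1/ b)) 0<p , (begin-equality
  b ℚ.* (ℚ.1/ b ℚ.* p) ≡⟨ ℚ.*-assoc b (ℚ.1/ b) p ⟨
  b ℚ.* ℚ.1/ b ℚ.* p   ≡⟨ cong (ℚ._* p) (ℚ.*-inverseʳ b) ⟩
  1ℚ ℚ.* p             ≡⟨ ℚ.*-identityˡ p ⟩
  p                    ∎)
  where
  open ℚ.≤-Reasoning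
  instance
    _ : ℚ.Positive b
    _ = ℚ.positive 0<b
    _ : ℚ.NonZero b
    _ = ℚ.pos⇒nonZero b
    _ : ℚ.Positive (ℚ.1/ b)
    _ = ℚ.1/pos⇒pos b

half : ∀ {p} → 0ℚ ℚ.< p → ∃[ q ] (0ℚ ℚ.< q × q ℚ.+ q ≡ p)
half {p} 0<p with ℚ-quotient {1ℚ ℚ.+ 1ℚ} (ℚ.positive⁻¹ (1ℚ ℚ.+ 1ℚ)) 0<p
... | q , 0<q , e = q , 0<q , trans (solve 1 (λ q → q :+ q := con (1ℚ ℚ.+ 1ℚ) :* q) refl q) e

-- `i / 1` is normalised through a gcd and does not reduce for a variable `i`; this form exposes
-- numerator and denominator.
ℤ⇒ℚ≡mkℚ : ∀ i → ℤ⇒ℚ i ≡ mkℚ i 0 (Coprime.sym (Coprime.1-coprimeTo ℤ.∣ i ∣))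
ℤ⇒ℚ≡mkℚ i = ℚ.↥p/↧p≡p (mkℚ i 0 _)

ℤ⇒ℚ-injective : ∀ {i j} → ℤ⇒ℚ i ≡ ℤ⇒ℚ j → i ≡ j
ℤ⇒ℚ-injective {i} {j} e =
  cong ℚ.↥_ (trans (sym (ℤ⇒ℚ≡mkℚ i)) (trans e (ℤ⇒ℚ≡mkℚ j)))

ℤ⇒ℚ-mono-≤ : ∀ {i j} → i ≤ℤ j → ℤ⇒ℚ i ℚ.≤ ℤ⇒ℚ j
ℤ⇒ℚ-mono-≤ {i} {j} i≤j = subst₂ ℚ._≤_ (sym (ℤ⇒ℚ≡mkℚ i)) (sym (ℤ⇒ℚ≡mkℚ j))
  (ℚ.*≤* (ℤ.*-monoʳ-≤-nonNeg 1ℤ i≤j))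

ℤ⇒ℚ-homo-+ : ∀ i j → ℤ⇒ℚ (i +ℤ j) ≡ ℤ⇒ℚ i ℚ.+ ℤ⇒ℚ j
ℤ⇒ℚ-homo-+ i j = trans
  -- The sum of two fractions with denominator 1 unfolds to `(i * 1 + j * 1) / 1`, hence the
  -- inserted factors 1.
  (cong ℤ⇒ℚ (sym (cong₂ _+ℤ_ (ℤ.*-identityʳ i) (ℤ.*-identityʳ j))))
  (sym (cong₂ ℚ._+_ (ℤ⇒ℚ≡mkℚ i) (ℤ⇒ℚ≡mkℚ j)))

ℤ⇒ℚ-homo-neg : ∀ i → ℤ⇒ℚ (-ℤ i) ≡ ℚ.- ℤ⇒ℚ i
ℤ⇒ℚ-homo-neg i = begin-equality
  ℤ⇒ℚ (-ℤ i)                             ≡⟨ solve 2 (λ p q → p := (q :+ p) :- q) refl (ℤ⇒ℚ (-ℤ i)) (ℤ⇒ℚ i) ⟩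
  (ℤ⇒ℚ i ℚ.+ ℤ⇒ℚ (-ℤ i)) ℚ.- ℤ⇒ℚ i       ≡⟨ cong (ℚ._- ℤ⇒ℚ i) (ℤ⇒ℚ-homo-+ i (-ℤ i)) ⟨
  ℤ⇒ℚ (i +ℤ -ℤ i) ℚ.- ℤ⇒ℚ i              ≡⟨ cong (λ k → ℤ⇒ℚ k ℚ.- ℤ⇒ℚ i) (ℤ.+-inverseʳ i) ⟩
  0ℚ ℚ.- ℤ⇒ℚ i                           ≡⟨ ℚ.+-identityˡ (ℚ.- ℤ⇒ℚ i) ⟩
  ℚ.- ℤ⇒ℚ i                              ∎
  where open ℚ.≤-Reasoning

-- Additive rearrangements of an inequality or equality between reals are
-- identities between the differences of the two sides, which hold termwise
-- and so are left to the ring solver of ℚ.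

<-shift : ∀ x y x′ y′ →
  (∀ n → seq y n ℚ.- seq x n ≡ seq y′ n ℚ.- seq x′ n) → x < y → x′ < y′
<-shift x y x′ y′ e (ε , ε>0 , N , h) = ε , ε>0 , N , λ n N≤n →
  r≤q-p⇒p+r≤q (subst (ε ℚ.≤_) (e n) (p+r≤q⇒r≤q-p (h n N≤n)))

≤-shift : ∀ x y x′ y′ →
  (∀ n → seq x n ℚ.- seq y n ≡ seq x′ n ℚ.- seq y′ n) → x ≤ y → x′ ≤ y′
≤-shift x y x′ y′ e h ε ε>0 = proj₁ (h ε ε>0) , λ n N≤n →
  p-q≤r⇒p≤q+r (subst (ℚ._≤ ε) (e n) (p≤q+r⇒p-q≤r (proj₂ (h ε ε>0) n N≤n)))

≈-shift : ∀ x y x′ y′ →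
  (∀ n → seq x n ℚ.- seq y n ≡ seq x′ n ℚ.- seq y′ n) → x ≈ y → x′ ≈ y′
≈-shift x y x′ y′ e h ε ε>0 = proj₁ (h ε ε>0) , λ n N≤n →
  subst (λ d → ℚ.∣ d ∣ ℚ.≤ ε) (e n) (proj₂ (h ε ε>0) n N≤n)

≤-refl : ∀ x → x ≤ x
≤-refl x ε ε>0 = 0 , λ n _ → 0≤p⇒q≤q+p (seq x n) (ℚ.<⇒≤ ε>0)

<⇒≤ : ∀ x y → x < y → x ≤ y
<⇒≤ x y (δ , δ>0 , N , h) ε ε>0 = N , λ n N≤n →
  ℚ.≤-trans (0≤p⇒q≤q+p (seq x n) (ℚ.<⇒≤ δ>0))
  (ℚ.≤-trans (h n N≤n) (0≤p⇒q≤q+p (seq y n) (ℚ.<⇒≤ ε>0)))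

≤-trans : ∀ x y z → x ≤ y → y ≤ z → x ≤ z
≤-trans x y z x≤y y≤z ε ε>0 = N ℕ.⊔ M , λ n p → begin
  seq x n               ≤⟨ proj₂ (x≤y η η>0) n (ℕ.m⊔n≤o⇒m≤o N M p) ⟩
  seq y n ℚ.+ η         ≤⟨ ℚ.+-monoˡ-≤ η (proj₂ (y≤z η η>0) n (ℕ.m⊔n≤o⇒n≤o N M p)) ⟩
  seq z n ℚ.+ η ℚ.+ η   ≡⟨ ℚ.+-assoc (seq z n) η η ⟩
  seq z n ℚ.+ (η ℚ.+ η) ≡⟨ cong (seq z n ℚ.+_) (proj₂ (proj₂ (half ε>0))) ⟩
  seq z n ℚ.+ ε         ∎
  where
  open ℚ.≤-Reasoning
  η = proj₁ (half ε>0)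
  η>0 = proj₁ (proj₂ (half ε>0))
  N = proj₁ (x≤y η η>0)
  M = proj₁ (y≤z η η>0)

<-≤-trans : ∀ x y z → x < y → y ≤ z → x < z
<-≤-trans x y z (ε , ε>0 , N , h) y≤z = η , η>0 , N ℕ.⊔ M , λ n p → begin
  seq x n ℚ.+ η                 ≡⟨ solve 2 (λ x η → x :+ η := (x :+ (η :+ η)) :- η) refl (seq x n) η ⟩
  (seq x n ℚ.+ (η ℚ.+ η)) ℚ.- η ≡⟨ cong (λ δ → (seq x n ℚ.+ δ) ℚ.- η) (proj₂ (proj₂ (half ε>0))) ⟩
  (seq x n ℚ.+ ε) ℚ.- η         ≤⟨ ℚ.+-monoˡ-≤ (ℚ.- η) (h n (ℕ.m⊔n≤o⇒m≤o N M p)) ⟩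
  seq y n ℚ.- η                 ≤⟨ ℚ.+-monoˡ-≤ (ℚ.- η) (proj₂ (y≤z η η>0) n (ℕ.m⊔n≤o⇒n≤o N M p)) ⟩
  (seq z n ℚ.+ η) ℚ.- η         ≡⟨ solve 2 (λ z η → (z :+ η) :- η := z) refl (seq z n) η ⟩
  seq z n                       ∎
  where
  open ℚ.≤-Reasoning
  η = proj₁ (half ε>0)
  η>0 = proj₁ (proj₂ (half ε>0))
  M = proj₁ (y≤z η η>0)

≤-<-trans : ∀ x y z → x ≤ y → y < z → x < z
≤-<-trans x y z x≤y y<z = <-shift (- z) (- x) x z
  (λ n → solve 2 (λ x z → :- x :- :- z := z :- x) refl (seq x n) (seq z n))
  (<-≤-trans (- z) (- y) (- x)
    (<-shift y z (- z) (- y)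
      (λ n → solve 2 (λ y z → z :- y := :- y :- :- z) refl (seq y n) (seq z n)) y<z)
    (≤-shift x y (- y) (- x)
      (λ n → solve 2 (λ x y → x :- y := :- y :- :- x) refl (seq x n) (seq y n)) x≤y))

<-trans : ∀ x y z → x < y → y < z → x < z
<-trans x y z x<y y<z = <-≤-trans x y z x<y (<⇒≤ y z y<z)

<-irrefl : ∀ x → ¬ (x < x)
<-irrefl x (ε , ε>0 , N , h) = ℚ.<-irrefl refl (ℚ.<-≤-trans ε>0
  (subst (ε ℚ.≤_) (ℚ.+-inverseʳ (seq x N)) (p+r≤q⇒r≤q-p (h N ℕ.≤-refl))))

≈⇒≤ : ∀ x y → x ≈ y → x ≤ y
≈⇒≤ x y x≈y ε ε>0 = proj₁ (x≈y ε ε>0) , λ n N≤n →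
  p-q≤r⇒p≤q+r (ℚ.≤-trans (p≤∣p∣ (seq x n ℚ.- seq y n)) (proj₂ (x≈y ε ε>0) n N≤n))

≈-sym : ∀ x y → x ≈ y → y ≈ x
≈-sym x y x≈y ε ε>0 = proj₁ (x≈y ε ε>0) , λ n N≤n → begin
  ℚ.∣ seq y n ℚ.- seq x n ∣       ≡⟨ cong ℚ.∣_∣ (solve 2 (λ x y → y :- x := :- (x :- y)) refl (seq x n) (seq y n)) ⟩
  ℚ.∣ ℚ.- (seq x n ℚ.- seq y n) ∣ ≡⟨ ℚ.∣-p∣≡∣p∣ (seq x n ℚ.- seq y n) ⟩
  ℚ.∣ seq x n ℚ.- seq y n ∣       ≤⟨ proj₂ (x≈y ε ε>0) n N≤n ⟩
  ε                               ∎
  where open ℚ.≤-Reasoning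

≤-antisym : ∀ x y → x ≤ y → y ≤ x → x ≈ y
≤-antisym x y x≤y y≤x ε ε>0 = N ℕ.⊔ M , λ n p →
  ∣p∣≤q (p≤q+r⇒p-q≤r (proj₂ (x≤y ε ε>0) n (ℕ.m⊔n≤o⇒m≤o N M p)))
    (subst (ℚ._≤ ε) (solve 2 (λ x y → y :- x := :- (x :- y)) refl (seq x n) (seq y n))
      (p≤q+r⇒p-q≤r (proj₂ (y≤x ε ε>0) n (ℕ.m⊔n≤o⇒n≤o N M p))))
  where
  N = proj₁ (x≤y ε ε>0)
  M = proj₁ (y≤x ε ε>0)

≈-refl : ∀ x → x ≈ x
≈-refl x = ≤-antisym x x (≤-refl x) (≤-refl x)

≈-trans : ∀ x y z → x ≈ y → y ≈ z → x ≈ z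
≈-trans x y z x≈y y≈z = ≤-antisym x z
  (≤-trans x y z (≈⇒≤ x y x≈y) (≈⇒≤ y z y≈z))
  (≤-trans z y x (≈⇒≤ z y (≈-sym y z y≈z)) (≈⇒≤ y x (≈-sym x y x≈y)))

0<⇒eventually : ∀ x → 0ℝ < x →
  ∃[ ε ] (0ℚ ℚ.< ε × ∃[ N ] (∀ n → N ℕ.≤ n → ε ℚ.≤ seq x n))
0<⇒eventually x (ε , ε>0 , N , h) = ε , ε>0 , N , λ n N≤n →
  subst (ℚ._≤ seq x n) (ℚ.+-identityˡ ε) (h n N≤n)

upper-bound : ∀ x → ∃[ b ] (0ℚ ℚ.< b × ∃[ N ] (∀ n → N ℕ.≤ n → seq x n ℚ.≤ b))
upper-bound x = ℚ.∣ seq x N ∣ ℚ.+ 1ℚ ,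
  ℚ.<-≤-trans (ℚ.positive⁻¹ 1ℚ) (ℚ.+-monoˡ-≤ 1ℚ (ℚ.0≤∣p∣ (seq x N))) ,
  N , λ n N≤n → ℚ.≤-trans
    (p-q≤r⇒p≤q+r {seq x n} {seq x N} (ℚ.≤-trans (p≤∣p∣ (seq x n ℚ.- seq x N))
      (proj₂ (cauchy x 1ℚ (ℚ.positive⁻¹ 1ℚ)) n N N≤n ℕ.≤-refl)))
    (ℚ.+-monoˡ-≤ 1ℚ (p≤∣p∣ (seq x N)))
  where
  N = proj₁ (cauchy x 1ℚ (ℚ.positive⁻¹ 1ℚ))

-- An eventual lower bound `δ` of `z` turns the gap `ε` into `δ * ε`.
*-monoˡ-< : ∀ z x y → 0ℝ < z → x < y → z * x < z * y
*-monoˡ-< z x y 0<z (ε , ε>0 , N , h) = δ ℚ.* ε , 0<p*q δ>0 ε>0 , N ℕ.⊔ M , λ n p →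
  let δ≤z = proj₂ (proj₂ (proj₂ (0<⇒eventually z 0<z))) n (ℕ.m⊔n≤o⇒n≤o N M p)
      instance
        _ = ℚ.nonNegative (ℚ.<⇒≤ ε>0)
        _ = ℚ.nonNegative (ℚ.≤-trans (ℚ.<⇒≤ δ>0) δ≤z)
  in begin
    seq z n ℚ.* seq x n ℚ.+ δ ℚ.* ε       ≤⟨ ℚ.+-monoʳ-≤ (seq z n ℚ.* seq x n) (ℚ.*-monoʳ-≤-nonNeg ε δ≤z) ⟩
    seq z n ℚ.* seq x n ℚ.+ seq z n ℚ.* ε ≡⟨ ℚ.*-distribˡ-+ (seq z n) (seq x n) ε ⟨
    seq z n ℚ.* (seq x n ℚ.+ ε)           ≤⟨ ℚ.*-monoˡ-≤-nonNeg (seq z n) (h n (ℕ.m⊔n≤o⇒m≤o N M p)) ⟩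
    seq z n ℚ.* seq y n                   ∎
  where
  open ℚ.≤-Reasoning
  δ = proj₁ (0<⇒eventually z 0<z)
  δ>0 = proj₁ (proj₂ (0<⇒eventually z 0<z))
  M = proj₁ (proj₂ (proj₂ (0<⇒eventually z 0<z)))

-- η = ε / b, where b is an eventual upper bound of z.
absorb : ∀ z {ε} → 0ℝ < z → 0ℚ ℚ.< ε →
  ∃[ η ] (0ℚ ℚ.< η × ∃[ N ] (∀ n → N ℕ.≤ n → 0ℚ ℚ.< seq z n × seq z n ℚ.* η ℚ.≤ ε))
absorb z {ε} 0<z ε>0 = η , η>0 , N ℕ.⊔ M , λ n p →
  ℚ.<-≤-trans (proj₁ (proj₂ lower)) (proj₂ (proj₂ (proj₂ lower)) n (ℕ.m⊔n≤o⇒m≤o N M p)) ,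
  subst (seq z n ℚ.* η ℚ.≤_) (proj₂ (proj₂ quotient))
    (ℚ.*-monoʳ-≤-nonNeg η {{ℚ.nonNegative (ℚ.<⇒≤ η>0)}}
      (proj₂ (proj₂ (proj₂ upper)) n (ℕ.m⊔n≤o⇒n≤o N M p)))
  where
  lower = 0<⇒eventually z 0<z
  upper = upper-bound z
  quotient = ℚ-quotient (proj₁ (proj₂ upper)) ε>0
  η = proj₁ quotient
  η>0 = proj₁ (proj₂ quotient)
  N = proj₁ (proj₂ (proj₂ lower))
  M = proj₁ (proj₂ (proj₂ upper))

-- The error `η` allowed in `x ≤ y` is multiplied by `z`; `absorb` chooses it so small that the
-- product stays below `ε`.
*-monoˡ-≤ : ∀ z x y → 0ℝ < z → x ≤ y → z * x ≤ z * y
*-monoˡ-≤ z x y 0<z x≤y ε ε>0 = N ℕ.⊔ M , λ n p →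
  let 0<zₙ , zη≤ε = proj₂ (proj₂ (proj₂ absorbed)) n (ℕ.m⊔n≤o⇒n≤o N M p)
      instance _ = ℚ.nonNegative (ℚ.<⇒≤ 0<zₙ)
  in begin
    seq z n ℚ.* seq x n                   ≤⟨ ℚ.*-monoˡ-≤-nonNeg (seq z n) (proj₂ (x≤y η η>0) n (ℕ.m⊔n≤o⇒m≤o N M p)) ⟩
    seq z n ℚ.* (seq y n ℚ.+ η)           ≡⟨ ℚ.*-distribˡ-+ (seq z n) (seq y n) η ⟩
    seq z n ℚ.* seq y n ℚ.+ seq z n ℚ.* η ≤⟨ ℚ.+-monoʳ-≤ (seq z n ℚ.* seq y n) zη≤ε ⟩
    seq z n ℚ.* seq y n ℚ.+ ε             ∎
  where
  open ℚ.≤-Reasoning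
  absorbed = absorb z 0<z ε>0
  η = proj₁ absorbed
  η>0 = proj₁ (proj₂ absorbed)
  N = proj₁ (x≤y η η>0)
  M = proj₁ (proj₂ (proj₂ absorbed))

*-congˡ : ∀ z x y → 0ℝ < z → x ≈ y → z * x ≈ z * y
*-congˡ z x y 0<z x≈y = ≤-antisym (z * x) (z * y)
  (*-monoˡ-≤ z x y 0<z (≈⇒≤ x y x≈y))
  (*-monoˡ-≤ z y x 0<z (≈⇒≤ y x (≈-sym x y x≈y)))

*-cancelˡ-< : ∀ z x y → 0ℝ < z → z * x < z * y → x < y
*-cancelˡ-< z x y 0<z (ε , ε>0 , N , h) = η , proj₁ (proj₂ absorbed) , N ℕ.⊔ M , λ n p →
  let 0<zₙ , zη≤ε = proj₂ (proj₂ (proj₂ absorbed)) n (ℕ.m⊔n≤o⇒n≤o N M p)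
      instance _ = ℚ.positive 0<zₙ
  in ℚ.*-cancelˡ-≤-pos (seq z n) (begin
    seq z n ℚ.* (seq x n ℚ.+ η)           ≡⟨ ℚ.*-distribˡ-+ (seq z n) (seq x n) η ⟩
    seq z n ℚ.* seq x n ℚ.+ seq z n ℚ.* η ≤⟨ ℚ.+-monoʳ-≤ (seq z n ℚ.* seq x n) zη≤ε ⟩
    seq z n ℚ.* seq x n ℚ.+ ε             ≤⟨ h n (ℕ.m⊔n≤o⇒m≤o N M p) ⟩
    seq z n ℚ.* seq y n                   ∎)
  where
  open ℚ.≤-Reasoning
  absorbed = absorb z 0<z ε>0
  η = proj₁ absorbed
  M = proj₁ (proj₂ (proj₂ absorbed))

fromℤ-mono-≤ : ∀ {i j} → i ≤ℤ j → fromℤ i ≤ fromℤ j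
fromℤ-mono-≤ i≤j ε ε>0 = 0 , λ _ _ →
  ℚ.≤-trans (ℤ⇒ℚ-mono-≤ i≤j) (0≤p⇒q≤q+p _ (ℚ.<⇒≤ ε>0))

fromℤ-cancel-< : ∀ {i j} → fromℤ i < fromℤ j → i ℤ.< j
fromℤ-cancel-< {i} {j} i<j with i ℤ.<? j
... | yes p = p
... | no ¬p = ⊥-elim (<-irrefl (fromℤ i)
  (<-≤-trans (fromℤ i) (fromℤ j) (fromℤ i) i<j (fromℤ-mono-≤ (ℤ.≮⇒≥ ¬p))))

0<1 : 0ℝ < 1ℝ
0<1 = 1ℚ , ℚ.positive⁻¹ 1ℚ , 0 , λ _ _ → ℚ.≤-refl

-- Remainders and greedy digits

remainder≥0 : ∀ β c → IsGreedyExpansion β c → ∀ n → 0ℝ ≤ remainder β c n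
remainder≥0 β c greedy zero    = <⇒≤ 0ℝ 1ℝ 0<1
remainder≥0 β c greedy (suc n) =
  ≤-shift (fromℤ (c n)) (β * remainder β c n) 0ℝ (remainder β c (suc n))
    (λ m → solve 3 (λ b r d → d :- b :* r := con 0ℚ :- (b :* r :- d)) refl
      (seq β m) (seq (remainder β c n) m) (ℤ⇒ℚ (c n)))
    (proj₁ (greedy n))

remainder<1 : ∀ β c → IsGreedyExpansion β c → ∀ n → remainder β c (suc n) < 1ℝ
remainder<1 β c greedy n =
  <-shift (β * remainder β c n) (fromℤ (c n +ℤ 1ℤ)) (remainder β c (suc n)) 1ℝ
    (λ m → trans
      (cong (ℚ._- (seq β m ℚ.* seq (remainder β c n) m)) (ℤ⇒ℚ-homo-+ (c n) 1ℤ))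
      (solve 3 (λ b r d → (d :+ con 1ℚ) :- b :* r := con 1ℚ :- (b :* r :- d)) refl
        (seq β m) (seq (remainder β c n) m) (ℤ⇒ℚ (c n))))
    (proj₂ (greedy n))

-- Both floor inequalities, with the digit moved to the other side, are bounds on the next
-- remainder. Greediness thus becomes a statement about remainders alone.
remainders⇒greedy : ∀ β c → (∀ n → 0ℝ ≤ remainder β c (suc n)) →
  (∀ n → remainder β c (suc n) < 1ℝ) → IsGreedyExpansion β c
remainders⇒greedy β c r≥0 r<1 n =
  ≤-shift 0ℝ (remainder β c (suc n)) (fromℤ (c n)) (β * remainder β c n)
    (λ m → solve 3 (λ b r d → con 0ℚ :- (b :* r :- d) := d :- b :* r) refl
      (seq β m) (seq (remainder β c n) m) (ℤ⇒ℚ (c n)))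
    (r≥0 n) ,
  <-shift (remainder β c (suc n)) 1ℝ (β * remainder β c n) (fromℤ (c n +ℤ 1ℤ))
    (λ m → trans
      (solve 3 (λ b r d → con 1ℚ :- (b :* r :- d) := (d :+ con 1ℚ) :- b :* r) refl
        (seq β m) (seq (remainder β c n) m) (ℤ⇒ℚ (c n)))
      (cong (ℚ._- (seq β m ℚ.* seq (remainder β c n) m)) (sym (ℤ⇒ℚ-homo-+ (c n) 1ℤ))))
    (r<1 n)

i<j+1⇒i≤j : ∀ {i j} → i ℤ.< j +ℤ 1ℤ → i ≤ℤ j
i<j+1⇒i≤j {i} {j} h = subst (i ≤ℤ_)
  (trans (cong ℤ.pred (ℤ.+-comm j 1ℤ)) (ℤ.pred-suc j)) (ℤ.i<j⇒i≤pred[j] h)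

-- From i ≤ x ≤ y < j + 1 the real comparison i < j + 1 descends to integers, where the order is
-- decidable. Digits are compared in this way without computing a floor.
floor-mono : ∀ x y {i j} → x ≤ y → IsFloor x i → IsFloor y j → i ≤ℤ j
floor-mono x y {i} {j} x≤y (i≤x , _) (_ , y<j+1) = i<j+1⇒i≤j (fromℤ-cancel-<
  (≤-<-trans (fromℤ i) x (fromℤ (j +ℤ 1ℤ)) i≤x (≤-<-trans x y (fromℤ (j +ℤ 1ℤ)) x≤y y<j+1)))

module _ (β : ℝ) (0<β : 0ℝ < β) where

  greedy-digit≥0 : ∀ c → IsGreedyExpansion β c → ∀ n → 0ℤ ≤ℤ c n
  greedy-digit≥0 c greedy n = i<j+1⇒i≤j (fromℤ-cancel-<
    (≤-<-trans 0ℝ (β * remainder β c n) (fromℤ (c n +ℤ 1ℤ))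
      (≤-trans 0ℝ (β * 0ℝ) (β * remainder β c n)
        (≤-shift 0ℝ 0ℝ 0ℝ (β * 0ℝ)
          (λ m → solve 1 (λ b → con 0ℚ :- con 0ℚ := con 0ℚ :- b :* con 0ℚ) refl (seq β m))
          (≤-refl 0ℝ))
        (*-monoˡ-≤ β 0ℝ (remainder β c n) 0<β (remainder≥0 β c greedy n)))
      (proj₂ (greedy n))))

  greedy-mono : ∀ c → IsGreedyExpansion β c → ∀ n k →
    remainder β c n < remainder β c k → c n ≤ℤ c k
  greedy-mono c greedy n k r<s = floor-mono (β * r) (β * s)
    (*-monoˡ-≤ β r s 0<β (<⇒≤ r s r<s)) (greedy n) (greedy k)
    where
    r = remainder β c n
    s = remainder β c k

  -- Equal digits cancel, leaving multiplication by `β`. A strict comparison of remainders thus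
  -- survives a tie and bears on the next digit.
  remainder-< : ∀ c n k → c n ≡ c k →
    remainder β c n < remainder β c k → remainder β c (suc n) < remainder β c (suc k)
  remainder-< c n k cₙ≡cₖ r<s =
    <-shift (β * r) (β * s) (β * r - fromℤ (c n)) (β * s - fromℤ (c k))
      (λ m → trans
        (solve 4 (λ b r s d → b :* s :- b :* r := (b :* s :- d) :- (b :* r :- d)) refl
          (seq β m) (seq r m) (seq s m) (ℤ⇒ℚ (c k)))
        (cong (λ i → (seq β m ℚ.* seq s m ℚ.- ℤ⇒ℚ (c k)) ℚ.- (seq β m ℚ.* seq r m ℚ.- ℤ⇒ℚ i))
          (sym cₙ≡cₖ)))
      (*-monoˡ-< β r s 0<β r<s)
    where
    r = remainder β c n
    s = remainder β c k

  -- Induction on the remainders: equal remainders have equal floors, and equal floors make the next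
  -- remainders equal.
  greedy-unique : ∀ c d → IsGreedyExpansion β c → IsGreedyExpansion β d → ∀ n → c n ≡ d n
  greedy-unique c d gc gd n = digits-agree (remainders-agree n)
    where
    digits-agree : ∀ {n} → remainder β c n ≈ remainder β d n → c n ≡ d n
    digits-agree {n} e = ℤ.≤-antisym
      (floor-mono (β * r) (β * s) (*-monoˡ-≤ β r s 0<β (≈⇒≤ r s e)) (gc n) (gd n))
      (floor-mono (β * s) (β * r) (*-monoˡ-≤ β s r 0<β (≈⇒≤ s r (≈-sym r s e))) (gd n) (gc n))
      where
      r = remainder β c n
      s = remainder β d n

    remainders-agree : ∀ n → remainder β c n ≈ remainder β d n
    remainders-agree zero    = ≈-refl 1ℝ
    remainders-agree (suc n) =
      ≈-shift (β * r) (β * s) (β * r - fromℤ (c n)) (β * s - fromℤ (d n))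
        (λ m → trans
          (solve 4 (λ b r s d → b :* r :- b :* s := (b :* r :- d) :- (b :* s :- d)) refl
            (seq β m) (seq r m) (seq s m) (ℤ⇒ℚ (c n)))
          (cong (λ i → (seq β m ℚ.* seq r m ℚ.- ℤ⇒ℚ (c n)) ℚ.- (seq β m ℚ.* seq s m ℚ.- ℤ⇒ℚ i))
            (digits-agree (remainders-agree n))))
        (*-congˡ β r s 0<β (remainders-agree n))
      where
      r = remainder β c n
      s = remainder β d n

-- Comparison up to an expanding factor

infix 4 _⊏_

-- x ⊏ y gives y > 0 ⇒ x > 0, is transitive, and forces x > 0 when x = y.
_⊏_ : ℝ → ℝ → Set
x ⊏ y = ∃[ z ] (1ℝ < z × y < z * x)

1<z⇒0<z : ∀ z → 1ℝ < z → 0ℝ < z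
1<z⇒0<z z = <-trans 0ℝ 1ℝ z 0<1

1<w*z : ∀ w z → 1ℝ < w → 1ℝ < z → 1ℝ < w * z
1<w*z w z 1<w 1<z = <-trans 1ℝ w (w * z) 1<w
  (<-shift (w * 1ℝ) (w * z) w (w * z)
    (λ n → solve 2 (λ w z → w :* z :- w :* con 1ℚ := w :* z :- w) refl (seq w n) (seq z n))
    (*-monoˡ-< w 1ℝ z (1<z⇒0<z w 1<w) 1<z))

⊏-trans : ∀ x y z → x ⊏ y → y ⊏ z → x ⊏ z
⊏-trans x y z (v , 1<v , y<vx) (w , 1<w , z<wy) = w * v , 1<w*z w v 1<w 1<v ,
  <-trans z (w * y) (w * v * x) z<wy
    (<-shift (w * y) (w * (v * x)) (w * y) (w * v * x)
      (λ n → solve 4 (λ w y v x → w :* (v :* x) :- w :* y := w :* v :* x :- w :* y) refl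
        (seq w n) (seq y n) (seq v n) (seq x n))
      (*-monoˡ-< w y (v * x) (1<z⇒0<z w 1<w) y<vx))

⊏⇒0< : ∀ x y → x ⊏ y → 0ℝ ≤ y → 0ℝ < x
⊏⇒0< x y (z , 1<z , y<zx) 0≤y = *-cancelˡ-< z 0ℝ x (1<z⇒0<z z 1<z)
  (<-shift 0ℝ (z * x) (z * 0ℝ) (z * x)
    (λ n → solve 2 (λ z x → z :* x :- con 0ℚ := z :* x :- z :* con 0ℚ) refl (seq z n) (seq x n))
    (≤-<-trans 0ℝ y (z * x) 0≤y y<zx))

⊏-self⇒0< : ∀ x → x ⊏ x → 0ℝ < x
-- x < zx says 0 < (z - 1)x, and z - 1 is positive.
⊏-self⇒0< x (z , 1<z , x<zx) = *-cancelˡ-< (z - 1ℝ) 0ℝ x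
  (<-shift 1ℝ z 0ℝ (z - 1ℝ)
    (λ n → solve 1 (λ z → z :- con 1ℚ := (z :- con 1ℚ) :- con 0ℚ) refl (seq z n)) 1<z)
  (<-shift x (z * x) ((z - 1ℝ) * 0ℝ) ((z - 1ℝ) * x)
    (λ n → solve 2 (λ z x → z :* x :- x := (z :- con 1ℚ) :* x :- (z :- con 1ℚ) :* con 0ℚ) refl
      (seq z n) (seq x n)) x<zx)

-- Closes a chain around the period: its end equals its start only up to `_≈_`, which supplies the
-- `≤`.
⊏-≥-trans : ∀ x y z → x ⊏ y → z ≤ y → x ⊏ z
⊏-≥-trans x y z (w , 1<w , y<wx) z≤y = w , 1<w , ≤-<-trans z y (w * x) z≤y y<wx

-- Lex c k n m: the sequences cₙ, cₙ₊₁, … and cₖ, cₖ₊₁, … first differ at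
-- cₘ₋₁, where the former is smaller.
data Lex (c : ℕ → ℤ) : ℕ → ℕ → ℕ → Set where
  here  : ∀ {k n} → c n ℤ.< c k → Lex c k n (suc n)
  there : ∀ {k n m} → c n ≡ c k → Lex c (suc k) (suc n) m → Lex c k n m

module _ (β : ℝ) (1<β : 1ℝ < β) (c : ℕ → ℤ) where

  private
    r : ℕ → ℝ
    r = remainder β c

    0<β : 0ℝ < β
    0<β = 1<z⇒0<z β 1<β

  -- Where the digits differ, `c k` is at least `1 + c n`, so β(r_k - r_n) = c_k + r_{k+1} - c_n -
  -- r_{n+1} exceeds 1 - r_{n+1}, as r_{k+1} > 0. Each tie before that contributes a further factor
  -- `β`. At `k` = 0, where r_0 = 1, this compares 1 - r_n with 1 - r_m.
  remainder-gap : (∀ n → 0ℝ < r (suc n)) → ∀ {k n m} → Lex c k n m →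
    r k - r n ⊏ 1ℝ - r m
  remainder-gap r>0 {k} {n} (here cₙ<cₖ) = β , 1<β ,
    <-shift (fromℤ (1ℤ +ℤ c n)) (fromℤ (c k) + r (suc k)) (1ℝ - r (suc n)) (β * (r k - r n))
      (λ m → trans
        (cong (λ p → (ℤ⇒ℚ (c k) ℚ.+ seq (r (suc k)) m) ℚ.- p) (ℤ⇒ℚ-homo-+ 1ℤ (c n)))
        (solve 5 (λ b s t d e →
            (d :+ (b :* s :- d)) :- (con 1ℚ :+ e) := b :* (s :- t) :- (con 1ℚ :- (b :* t :- e)))
          refl (seq β m) (seq (r k) m) (seq (r n) m) (ℤ⇒ℚ (c k)) (ℤ⇒ℚ (c n))))
      (≤-<-trans (fromℤ (1ℤ +ℤ c n)) (fromℤ (c k)) (fromℤ (c k) + r (suc k))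
        (fromℤ-mono-≤ (ℤ.i<j⇒suc[i]≤j cₙ<cₖ))
        (<-shift 0ℝ (r (suc k)) (fromℤ (c k)) (fromℤ (c k) + r (suc k))
          (λ m → solve 2 (λ s d → s :- con 0ℚ := (d :+ s) :- d) refl (seq (r (suc k)) m) (ℤ⇒ℚ (c k)))
          (r>0 k)))
  remainder-gap r>0 {k} {n} {m} (there cₙ≡cₖ lex) with remainder-gap r>0 lex
  ... | z , 1<z , gap = z * β , 1<w*z z β 1<z 1<β ,
    <-shift (1ℝ - r m) (z * (r (suc k) - r (suc n))) (1ℝ - r m) (z * β * (r k - r n))
      (λ i → trans
        (cong (λ d → seq z i ℚ.* ((seq β i ℚ.* seq (r k) i ℚ.- ℤ⇒ℚ (c k)) ℚ.-
            (seq β i ℚ.* seq (r n) i ℚ.- ℤ⇒ℚ d)) ℚ.- (1ℚ ℚ.- seq (r m) i)) cₙ≡cₖ)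
        (solve 6 (λ z b s t d u →
            z :* ((b :* s :- d) :- (b :* t :- d)) :- (con 1ℚ :- u) :=
            z :* b :* (s :- t) :- (con 1ℚ :- u))
          refl (seq z i) (seq β i) (seq (r k) i) (seq (r n) i) (ℤ⇒ℚ (c k)) (seq (r m) i)))
      gap

  remainder-step-≤ : ∀ n → 0ℤ ≤ℤ c n → r (suc n) ≤ β * r n
  remainder-step-≤ n 0≤cₙ = ≤-shift 0ℝ (fromℤ (c n)) (r (suc n)) (β * r n)
    (λ m → solve 3 (λ b s d → con 0ℚ :- d := (b :* s :- d) :- b :* s) refl
      (seq β m) (seq (r n) m) (ℤ⇒ℚ (c n)))
    (fromℤ-mono-≤ 0≤cₙ)

  remainder-step-⊏ : ∀ n → 1ℤ ≤ℤ c n → r n ⊏ r (suc n)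
  remainder-step-⊏ n 1≤cₙ = β , 1<β , <-shift 0ℝ (fromℤ (c n)) (r (suc n)) (β * r n)
    (λ m → solve 3 (λ b s d → d :- con 0ℚ := b :* s :- (b :* s :- d)) refl
      (seq β m) (seq (r n) m) (ℤ⇒ℚ (c n)))
    (<-≤-trans 0ℝ 1ℝ (fromℤ (c n)) 0<1 (fromℤ-mono-≤ 1≤cₙ))

  -- Since r_{n+1} ≤ β r_n, positivity travels backwards; positive remainders arbitrarily far out
  -- therefore suffice.
  remainder-pos-back : (∀ n → 0ℤ ≤ℤ c n) → ∀ k n → 0ℝ < r (k ℕ.+ n) → 0ℝ < r n
  remainder-pos-back c≥0 zero    n r>0 = r>0
  remainder-pos-back c≥0 (suc k) n r>0 = remainder-pos-back c≥0 k n
    (*-cancelˡ-< β 0ℝ (r (k ℕ.+ n)) 0<β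
      (<-shift 0ℝ (β * r (k ℕ.+ n)) (β * 0ℝ) (β * r (k ℕ.+ n))
        (λ m → solve 2 (λ b s → b :* s :- con 0ℚ := b :* s :- b :* con 0ℚ) refl
          (seq β m) (seq (r (k ℕ.+ n)) m))
        (<-≤-trans 0ℝ (r (suc (k ℕ.+ n))) (β * r (k ℕ.+ n)) r>0
          (remainder-step-≤ (k ℕ.+ n) (c≥0 (k ℕ.+ n))))))

  ⊏-remainder : (∀ n → 0ℤ ≤ℤ c n) → ∀ x k n → x ⊏ r n → x ⊏ r (k ℕ.+ n)
  ⊏-remainder c≥0 x zero    n x⊏r = x⊏r
  ⊏-remainder c≥0 x (suc k) n x⊏r with ⊏-remainder c≥0 x k n x⊏r
  ... | z , 1<z , s<zx = β * z , 1<w*z β z 1<β 1<z ,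
    ≤-<-trans (r (suc (k ℕ.+ n))) (β * s) (β * z * x)
      (remainder-step-≤ (k ℕ.+ n) (c≥0 (k ℕ.+ n)))
      (<-shift (β * s) (β * (z * x)) (β * s) (β * z * x)
        (λ m → solve 4 (λ b s z x → b :* (z :* x) :- b :* s := b :* z :* x :- b :* s) refl
          (seq β m) (seq s m) (seq z m) (seq x m))
        (*-monoˡ-< β s (z * x) 0<β s<zx))
    where s = r (k ℕ.+ n)

-- Polynomials

module _ (R : Ring 0ℓ 0ℓ) where
  private
    module R = Ring R
  open Polynomial R.rawRing

  coeff-⊕ : ∀ p q n → coeff (p ⊕ q) n R.≈ coeff p n R.+ coeff q n
  coeff-⊕ []      q       n       = R.sym (R.+-identityˡ (coeff q n))
  coeff-⊕ (a ∷ p) []      n       = R.sym (R.+-identityʳ (coeff (a ∷ p) n))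
  coeff-⊕ (a ∷ p) (b ∷ q) zero    = R.refl
  coeff-⊕ (a ∷ p) (b ∷ q) (suc n) = coeff-⊕ p q n

  coeff-scale : ∀ a p n → coeff (map (a R.*_) p) n R.≈ a R.* coeff p n
  coeff-scale a []      n       = R.sym (R.zeroʳ a)
  coeff-scale a (b ∷ p) zero    = R.refl
  coeff-scale a (b ∷ p) (suc n) = coeff-scale a p n

module ℤ[x] = Polynomial ℤ.+-*-rawRing
module ℚ[x] = Polynomial ℚ.+-*-rawRing

coeff-ℤ[x]⇒ℚ[x] : ∀ p n → ℚ[x].coeff (ℤ[x]⇒ℚ[x] p) n ≡ ℤ⇒ℚ (ℤ[x].coeff p n)
coeff-ℤ[x]⇒ℚ[x] []      n       = refl
coeff-ℤ[x]⇒ℚ[x] (a ∷ p) zero    = refl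
coeff-ℤ[x]⇒ℚ[x] (a ∷ p) (suc n) = coeff-ℤ[x]⇒ℚ[x] p n

-- Prepending two zeros is multiplication by x². Each coefficient of the product becomes a sum of
-- two coefficients of `p`, so equal coefficients of the factor carry over to the product.
coeff-⊗-x²+1 : ∀ p n →
  ℤ[x].coeff (p ⊗ (1ℤ ∷ 0ℤ ∷ 1ℤ ∷ [])) n ≡ ℤ[x].coeff p n +ℤ ℤ[x].coeff (0ℤ ∷ 0ℤ ∷ p) n
coeff-⊗-x²+1 [] zero          = refl
coeff-⊗-x²+1 [] (suc zero)    = refl
coeff-⊗-x²+1 [] (suc (suc n)) = refl
coeff-⊗-x²+1 (a ∷ p) zero     = solveℤ 1 (λ a → a :*ℤ conℤ 1ℤ :+ℤ conℤ 0ℤ :=ℤ a :+ℤ conℤ 0ℤ) refl a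
coeff-⊗-x²+1 (a ∷ p) (suc n)  = begin
  ℤ[x].coeff ((a *ℤ 0ℤ ∷ a *ℤ 1ℤ ∷ []) ℤ[x].⊕ (p ⊗ Q)) n
    ≡⟨ coeff-⊕ ℤ.+-*-ring (a *ℤ 0ℤ ∷ a *ℤ 1ℤ ∷ []) (p ⊗ Q) n ⟩
  ℤ[x].coeff (a *ℤ 0ℤ ∷ a *ℤ 1ℤ ∷ []) n +ℤ ℤ[x].coeff (p ⊗ Q) n
    ≡⟨ cong (ℤ[x].coeff (a *ℤ 0ℤ ∷ a *ℤ 1ℤ ∷ []) n +ℤ_) (coeff-⊗-x²+1 p n) ⟩
  ℤ[x].coeff (a *ℤ 0ℤ ∷ a *ℤ 1ℤ ∷ []) n +ℤ (ℤ[x].coeff p n +ℤ ℤ[x].coeff (0ℤ ∷ 0ℤ ∷ p) n)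
    ≡⟨ shifted n ⟩
  ℤ[x].coeff p n +ℤ ℤ[x].coeff (0ℤ ∷ a ∷ p) n ∎
  where
  open ≡-Reasoning
  Q = 1ℤ ∷ 0ℤ ∷ 1ℤ ∷ []
  shifted : ∀ n → ℤ[x].coeff (a *ℤ 0ℤ ∷ a *ℤ 1ℤ ∷ []) n +ℤ (ℤ[x].coeff p n +ℤ ℤ[x].coeff (0ℤ ∷ 0ℤ ∷ p) n)
            ≡ ℤ[x].coeff p n +ℤ ℤ[x].coeff (0ℤ ∷ a ∷ p) n
  shifted zero = solveℤ 2 (λ a u → a :*ℤ conℤ 0ℤ :+ℤ (u :+ℤ conℤ 0ℤ) :=ℤ u :+ℤ conℤ 0ℤ)
    refl a (ℤ[x].coeff p 0)
  shifted (suc zero) = solveℤ 2 (λ a u → a :*ℤ conℤ 1ℤ :+ℤ (u :+ℤ conℤ 0ℤ) :=ℤ u :+ℤ a)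
    refl a (ℤ[x].coeff p 1)
  shifted (suc (suc n)) = ℤ.+-identityˡ _

-- Real operations act termwise, so evaluation is additive as an equality of rationals at each
-- index, with no estimate.
seq-eval-⊕ : ∀ p q x n →
  seq (evalℚ (p ℚ[x].⊕ q) x) n ≡ seq (evalℚ p x) n ℚ.+ seq (evalℚ q x) n
seq-eval-⊕ []      q       x n = sym (ℚ.+-identityˡ (seq (evalℚ q x) n))
seq-eval-⊕ (a ∷ p) []      x n = sym (ℚ.+-identityʳ (seq (evalℚ (a ∷ p) x) n))
seq-eval-⊕ (a ∷ p) (b ∷ q) x n = trans
  (cong (λ u → a ℚ.+ b ℚ.+ seq x n ℚ.* u) (seq-eval-⊕ p q x n))
  (solve 5 (λ a b x u v → a :+ b :+ x :* (u :+ v) := (a :+ x :* u) :+ (b :+ x :* v)) refl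
    a b (seq x n) (seq (evalℚ p x) n) (seq (evalℚ q x) n))

seq-eval-scale : ∀ a p x n →
  seq (evalℚ (map (a ℚ.*_) p) x) n ≡ a ℚ.* seq (evalℚ p x) n
seq-eval-scale a []      x n = sym (ℚ.*-zeroʳ a)
seq-eval-scale a (b ∷ p) x n = trans
  (cong (λ u → a ℚ.* b ℚ.+ seq x n ℚ.* u) (seq-eval-scale a p x n))
  (solve 4 (λ a b x u → a :* b :+ x :* (a :* u) := a :* (b :+ x :* u)) refl
    a b (seq x n) (seq (evalℚ p x) n))

scale-root : ∀ a p x → a ≢ 0ℚ → evalℚ p x ≈ 0ℝ → evalℚ (map (a ℚ.*_) p) x ≈ 0ℝ
scale-root a p x a≢0 root ε ε>0 = proj₁ (root η η>0) , λ n N≤n → begin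
  ℚ.∣ seq (evalℚ (map (a ℚ.*_) p) x) n ℚ.- 0ℚ ∣
    ≡⟨ cong (λ u → ℚ.∣ u ℚ.- 0ℚ ∣) (seq-eval-scale a p x n) ⟩
  ℚ.∣ a ℚ.* seq (evalℚ p x) n ℚ.- 0ℚ ∣
    ≡⟨ cong ℚ.∣_∣ (solve 2 (λ a u → a :* u :- con 0ℚ := a :* (u :- con 0ℚ)) refl a (seq (evalℚ p x) n)) ⟩
  ℚ.∣ a ℚ.* (seq (evalℚ p x) n ℚ.- 0ℚ) ∣
    ≡⟨ ℚ.∣p*q∣≡∣p∣*∣q∣ a (seq (evalℚ p x) n ℚ.- 0ℚ) ⟩
  ℚ.∣ a ∣ ℚ.* ℚ.∣ seq (evalℚ p x) n ℚ.- 0ℚ ∣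
    ≤⟨ ℚ.*-monoˡ-≤-nonNeg ℚ.∣ a ∣ {{ℚ.∣-∣-nonNeg a}} (proj₂ (root η η>0) n N≤n) ⟩
  ℚ.∣ a ∣ ℚ.* η
    ≡⟨ proj₂ (proj₂ quotient) ⟩
  ε ∎
  where
  open ℚ.≤-Reasoning
  0<∣a∣ : 0ℚ ℚ.< ℚ.∣ a ∣
  0<∣a∣ = ℚ.≰⇒> λ ∣a∣≤0 → a≢0 (ℚ.∣p∣≡0⇒p≡0 a (ℚ.≤-antisym ∣a∣≤0 (ℚ.0≤∣p∣ a)))
  quotient = ℚ-quotient 0<∣a∣ ε>0
  η = proj₁ quotient
  η>0 = proj₁ (proj₂ quotient)

-- Otherwise the leading coefficient could be divided out, giving a monic
-- polynomial of degree < d with the same root.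
small-degree-root⇒≋0 : ∀ β d → (∀ q k → ℚ[x].MonicOfDegree q k → evalℚ q β ≈ 0ℝ → d ℕ.≤ k) →
  ∀ s → evalℚ s β ≈ 0ℝ → ∀ e → e ℕ.≤ d → (∀ k → e ℕ.≤ k → ℚ[x].coeff s k ≡ 0ℚ) →
  ∀ k → ℚ[x].coeff s k ≡ 0ℚ
small-degree-root⇒≋0 β d least s root zero    e≤d vanish k = vanish k ℕ.z≤n
small-degree-root⇒≋0 β d least s root (suc e) e<d vanish = by-cases (ℚ[x].coeff s e ℚ.≟ 0ℚ)
  where
  by-cases : Dec (ℚ[x].coeff s e ≡ 0ℚ) → ∀ k → ℚ[x].coeff s k ≡ 0ℚ
  by-cases (yes sₑ≡0) = small-degree-root⇒≋0 β d least s root e (ℕ.<⇒≤ e<d)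
    λ k e≤k → [ vanish k , (λ { refl → sₑ≡0 }) ]′ (ℕ.m≤n⇒m<n∨m≡n e≤k)
  by-cases (no sₑ≢0) = ⊥-elim (ℕ.<⇒≱ e<d (least (map (ℚ.1/ sₑ ℚ.*_) s) e
    ( trans (coeff-scale ℚ.+-*-ring (ℚ.1/ sₑ) s e) (ℚ.*-inverseˡ sₑ)
    , λ k e<k → trans (coeff-scale ℚ.+-*-ring (ℚ.1/ sₑ) s k)
        (trans (cong (ℚ.1/ sₑ ℚ.*_) (vanish k e<k)) (ℚ.*-zeroʳ (ℚ.1/ sₑ))))
    (scale-root (ℚ.1/ sₑ) s β 1/sₑ≢0 root)))
    where
    sₑ = ℚ[x].coeff s e
    instance
      _ : ℚ.NonZero sₑ
      _ = ℚ.≢-nonZero sₑ≢0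
    1/sₑ≢0 : ℚ.1/ sₑ ≢ 0ℚ
    1/sₑ≢0 1/sₑ≡0 = ℚ.1≢0 (trans (sym (ℚ.*-inverseˡ sₑ))
      (trans (cong (ℚ._* sₑ) 1/sₑ≡0) (ℚ.*-zeroˡ sₑ)))

-- Both polynomials are monic of the same least degree, so their difference `s` vanishes at `β` and
-- has smaller degree, hence is zero.
minimalPolynomial-unique : ∀ β p q → IsMinimalPolynomial β p → IsMinimalPolynomial β q →
  ∀ n → ℚ[x].coeff p n ≡ ℚ[x].coeff q n
minimalPolynomial-unique β p q mp mq n = begin
  pₙ                             ≡⟨ solve 2 (λ u v → u := (u :+ con (ℚ.- 1ℚ) :* v) :+ v) refl pₙ qₙ ⟩
  (pₙ ℚ.+ ℚ.- 1ℚ ℚ.* qₙ) ℚ.+ qₙ  ≡⟨ cong (ℚ._+ qₙ) (coeff-s n) ⟨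
  ℚ[x].coeff s n ℚ.+ qₙ          ≡⟨ cong (ℚ._+ qₙ) (small-degree-root⇒≋0 β P.degree P.least s root P.degree ℕ.≤-refl vanish n) ⟩
  0ℚ ℚ.+ qₙ                      ≡⟨ ℚ.+-identityˡ qₙ ⟩
  qₙ                             ∎
  where
  open ≡-Reasoning
  module P = IsMinimalPolynomial mp
  module Q = IsMinimalPolynomial mq
  pₙ = ℚ[x].coeff p n
  qₙ = ℚ[x].coeff q n
  s = p ℚ[x].⊕ map (ℚ.- 1ℚ ℚ.*_) q

  coeff-s : ∀ n → ℚ[x].coeff s n ≡ ℚ[x].coeff p n ℚ.+ ℚ.- 1ℚ ℚ.* ℚ[x].coeff q n
  coeff-s n = trans (coeff-⊕ ℚ.+-*-ring p _ n)
    (cong (ℚ[x].coeff p n ℚ.+_) (coeff-scale ℚ.+-*-ring (ℚ.- 1ℚ) q n))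

  same-degree : P.degree ≡ Q.degree
  same-degree = ℕ.≤-antisym (P.least q Q.degree Q.monic Q.root) (Q.least p P.degree P.monic P.root)

  vanish : ∀ k → P.degree ℕ.≤ k → ℚ[x].coeff s k ≡ 0ℚ
  vanish k d≤k = trans (coeff-s k) (by-cases (ℕ.m≤n⇒m<n∨m≡n d≤k))
    where
    by-cases : P.degree ℕ.< k ⊎ P.degree ≡ k →
      ℚ[x].coeff p k ℚ.+ ℚ.- 1ℚ ℚ.* ℚ[x].coeff q k ≡ 0ℚ
    by-cases (inj₁ d<k) = cong₂ (λ u v → u ℚ.+ ℚ.- 1ℚ ℚ.* v)
      (proj₂ P.monic k d<k) (proj₂ Q.monic k (subst (ℕ._< k) same-degree d<k))
    by-cases (inj₂ refl) = cong₂ (λ u v → u ℚ.+ ℚ.- 1ℚ ℚ.* v)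
      (proj₁ P.monic) (subst (λ d → ℚ[x].coeff q d ≡ 1ℚ) (sym same-degree) (proj₁ Q.monic))

  root : evalℚ s β ≈ 0ℝ
  root = ≈-shift (evalℚ p β) (evalℚ q β) (evalℚ s β) 0ℝ
    (λ m → sym (trans
      (cong (ℚ._- 0ℚ) (trans (seq-eval-⊕ p (map (ℚ.- 1ℚ ℚ.*_) q) β m)
        (cong (seq (evalℚ p β) m ℚ.+_) (seq-eval-scale (ℚ.- 1ℚ) q β m))))
      (solve 2 (λ u v → (u :+ con (ℚ.- 1ℚ) :* v) :- con 0ℚ := u :- v) refl
        (seq (evalℚ p β) m) (seq (evalℚ q β) m))))
    (≈-trans (evalℚ p β) 0ℝ (evalℚ q β) P.root (≈-sym (evalℚ q β) 0ℝ Q.root))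

minimalPolynomialℤ-unique : ∀ β p q →
  IsMinimalPolynomial β (ℤ[x]⇒ℚ[x] p) → IsMinimalPolynomial β (ℤ[x]⇒ℚ[x] q) → p ≋ q
minimalPolynomialℤ-unique β p q mp mq n = ℤ⇒ℚ-injective
  (trans (sym (coeff-ℤ[x]⇒ℚ[x] p n))
    (trans (minimalPolynomial-unique β (ℤ[x]⇒ℚ[x] p) (ℤ[x]⇒ℚ[x] q) mp mq n)
      (coeff-ℤ[x]⇒ℚ[x] q n)))

-- The digit sequence

-- Summands stand in the order in which they occur in the coefficients of P(x)(x² + 1), which is why
-- indices 2 and 4 differ in form. The last clause makes period 7 from index 1 on hold by
-- computation.
digits : ℤ → ℤ → ℤ → ℕ → ℤ
digits a b c 0 = -ℤ a
digits a b c 1 = -ℤ (1ℤ +ℤ b)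
digits a b c 2 = -ℤ (a +ℤ c)
digits a b c 3 = -ℤ (b +ℤ b)
digits a b c 4 = -ℤ (c +ℤ a)
digits a b c 5 = -ℤ (1ℤ +ℤ b)
digits a b c 6 = -ℤ (1ℤ +ℤ a)
digits a b c 7 = -ℤ (1ℤ +ℤ a)
digits a b c (suc (suc (suc (suc (suc (suc (suc (suc n)))))))) = digits a b c (suc n)

sextic : ℤ → ℤ → ℤ → ℤ[x]
sextic a b c = 1ℤ ∷ a ∷ b ∷ c ∷ b ∷ a ∷ 1ℤ ∷ []

x²+1 : ℤ[x]
x²+1 = 1ℤ ∷ 0ℤ ∷ 1ℤ ∷ []

companion-digits : ∀ a b c →
  companionPolynomial (digits a b c) 1 7 ≋ sextic a b c ⊗ x²+1
companion-digits a b c n = trans (by-coefficient n) (sym (coeff-⊗-x²+1 (sextic a b c) n))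
  where
  by-coefficient : ∀ n → ℤ[x].coeff (companionPolynomial (digits a b c) 1 7) n ≡
    ℤ[x].coeff (sextic a b c) n +ℤ ℤ[x].coeff (0ℤ ∷ 0ℤ ∷ sextic a b c) n
  -- The subtracted P_1(x) = x + a reaches only coefficients 0 and 1; the others are single negated
  -- digits or the leading 1.
  by-coefficient 0 = solveℤ 1 (λ a →
    :-ℤ :-ℤ (conℤ 1ℤ :+ℤ a) :+ℤ :-ℤ :-ℤ :-ℤ a :=ℤ conℤ 1ℤ :+ℤ conℤ 0ℤ) refl a
  by-coefficient 1 = solveℤ 1 (λ a →
    :-ℤ :-ℤ (conℤ 1ℤ :+ℤ a) :+ℤ conℤ -1ℤ :=ℤ a :+ℤ conℤ 0ℤ) refl a
  by-coefficient 2 = solveℤ 1 (λ b → :-ℤ :-ℤ (conℤ 1ℤ :+ℤ b) :=ℤ b :+ℤ conℤ 1ℤ) refl b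
  by-coefficient 3 = solveℤ 2 (λ a c → :-ℤ :-ℤ (c :+ℤ a) :=ℤ c :+ℤ a) refl a c
  by-coefficient 4 = solveℤ 1 (λ b → :-ℤ :-ℤ (b :+ℤ b) :=ℤ b :+ℤ b) refl b
  by-coefficient 5 = solveℤ 2 (λ a c → :-ℤ :-ℤ (a :+ℤ c) :=ℤ a :+ℤ c) refl a c
  by-coefficient 6 = solveℤ 1 (λ b → :-ℤ :-ℤ (conℤ 1ℤ :+ℤ b) :=ℤ conℤ 1ℤ :+ℤ b) refl b
  by-coefficient 7 = solveℤ 1 (λ a → :-ℤ :-ℤ a :=ℤ conℤ 0ℤ :+ℤ a) refl a
  by-coefficient 8 = refl
  by-coefficient (suc (suc (suc (suc (suc (suc (suc (suc (suc n))))))))) = refl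

-- P_1 has degree 1, so coefficients 3 to 7 of the companion polynomial are `- d 4` up to `- d 0`.
digits-determined : ∀ a b c d → companionPolynomial d 1 7 ≋ sextic a b c ⊗ x²+1 →
  d 0 ≡ digits a b c 0 × d 1 ≡ digits a b c 1 × d 2 ≡ digits a b c 2 ×
  d 3 ≡ digits a b c 3 × d 4 ≡ digits a b c 4
digits-determined a b c d e =
  trans (solved (coefficient 7)) (cong -ℤ_ (ℤ.+-identityˡ a)) ,
  solved (coefficient 6) , solved (coefficient 5) , solved (coefficient 4) , solved (coefficient 3)
  where
  solved : ∀ {i j} → -ℤ i ≡ j → i ≡ -ℤ j
  solved {i} e = trans (sym (ℤ.neg-involutive i)) (cong -ℤ_ e)

  coefficient : ∀ n → ℤ[x].coeff (companionPolynomial d 1 7) n ≡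
    ℤ[x].coeff (sextic a b c) n +ℤ ℤ[x].coeff (0ℤ ∷ 0ℤ ∷ sextic a b c) n
  coefficient n = trans (e n) (coeff-⊗-x²+1 (sextic a b c) n)

-- (β² + 1) P(β) = r₈ − r₁; the term y · 0 matches the shape produced by *-congˡ.
remainder-identity : ∀ x A B C D₀ D₁ D₂ D₃ D₄ D₆ →
  D₀ ≡ ℚ.- A → D₁ ≡ ℚ.- (1ℚ ℚ.+ B) → D₂ ≡ ℚ.- (A ℚ.+ C) → D₃ ≡ ℚ.- (B ℚ.+ B) →
  D₄ ≡ ℚ.- (C ℚ.+ A) → D₆ ≡ ℚ.- (1ℚ ℚ.+ A) →
  let r₁ = x ℚ.* 1ℚ ℚ.- D₀
      r₃ = x ℚ.* (x ℚ.* r₁ ℚ.- D₁) ℚ.- D₂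
      r₅ = x ℚ.* (x ℚ.* r₃ ℚ.- D₃) ℚ.- D₄
      r₇ = x ℚ.* (x ℚ.* r₅ ℚ.- D₁) ℚ.- D₆
      y = x ℚ.* x ℚ.+ 1ℚ
  in y ℚ.* (1ℚ ℚ.+ x ℚ.* (A ℚ.+ x ℚ.* (B ℚ.+ x ℚ.* (C ℚ.+ x ℚ.* (B ℚ.+ x ℚ.* (A ℚ.+
       x ℚ.* (1ℚ ℚ.+ x ℚ.* 0ℚ))))))) ℚ.- y ℚ.* 0ℚ
     ≡ (x ℚ.* r₇ ℚ.- D₆) ℚ.- r₁
remainder-identity x A B C _ _ _ _ _ _ refl refl refl refl refl refl = solve 4
  (λ x A B C →
    let D₁ = :- (con 1ℚ :+ B)
        D₆ = :- (con 1ℚ :+ A)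
        r₁ = x :* con 1ℚ :- :- A
        r₃ = x :* (x :* r₁ :- D₁) :- :- (A :+ C)
        r₅ = x :* (x :* r₃ :- :- (B :+ B)) :- :- (C :+ A)
        r₇ = x :* (x :* r₅ :- D₁) :- D₆
        y = x :* x :+ con 1ℚ
    in y :* (con 1ℚ :+ x :* (A :+ x :* (B :+ x :* (C :+ x :* (B :+ x :* (A :+
         x :* (con 1ℚ :+ x :* con 0ℚ))))))) :- y :* con 0ℚ
       := (x :* r₇ :- D₆) :- r₁)
  refl x A B C

ℤ⇒ℚ-neg-+ : ∀ i j → ℤ⇒ℚ (-ℤ (i +ℤ j)) ≡ ℚ.- (ℤ⇒ℚ i ℚ.+ ℤ⇒ℚ j)
ℤ⇒ℚ-neg-+ i j = trans (ℤ⇒ℚ-homo-neg (i +ℤ j)) (cong ℚ.-_ (ℤ⇒ℚ-homo-+ i j))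

-- At `zero` the root equation is multiplied by the positive number β² + 1. Afterwards both sides
-- subtract the same digit, so the equality propagates.
remainder-periodic : ∀ β a b c → 1ℝ < β → evalℚ (ℤ[x]⇒ℚ[x] (sextic a b c)) β ≈ 0ℝ →
  ∀ n → remainder β (digits a b c) (8 ℕ.+ n) ≈ remainder β (digits a b c) (1 ℕ.+ n)
remainder-periodic β a b c 1<β root zero =
  ≈-shift (y * p) (y * 0ℝ) (r 8) (r 1)
    (λ m → remainder-identity (seq β m) (ℤ⇒ℚ a) (ℤ⇒ℚ b) (ℤ⇒ℚ c) _ _ _ _ _ _
      (ℤ⇒ℚ-homo-neg a) (ℤ⇒ℚ-neg-+ 1ℤ b) (ℤ⇒ℚ-neg-+ a c) (ℤ⇒ℚ-neg-+ b b) (ℤ⇒ℚ-neg-+ c a)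
      (ℤ⇒ℚ-neg-+ 1ℤ a))
    (*-congˡ y p 0ℝ 0<y root)
  where
  r = remainder β (digits a b c)
  p = evalℚ (ℤ[x]⇒ℚ[x] (sextic a b c)) β
  y = β * β + 1ℝ
  0<y : 0ℝ < y
  0<y = <-trans 0ℝ 1ℝ y 0<1
    (<-shift 0ℝ (β * β) 1ℝ y
      (λ m → solve 1 (λ x → x :* x :- con 0ℚ := (x :* x :+ con 1ℚ) :- con 1ℚ) refl (seq β m))
      (<-trans 0ℝ 1ℝ (β * β) 0<1 (1<w*z β β 1<β 1<β)))
remainder-periodic β a b c 1<β root (suc n) =
  ≈-shift (β * s) (β * t) (β * s - fromℤ (digits a b c (suc n))) (β * t - fromℤ (digits a b c (suc n)))
    (λ m → solve 4 (λ b s t d → b :* s :- b :* t := (b :* s :- d) :- (b :* t :- d)) refl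
      (seq β m) (seq s m) (seq t m) (ℤ⇒ℚ (digits a b c (suc n))))
    (*-congˡ β s t (1<z⇒0<z β 1<β) (remainder-periodic β a b c 1<β root n))
  where
  s = remainder β (digits a b c) (8 ℕ.+ n)
  t = remainder β (digits a b c) (1 ℕ.+ n)

0≤i+j : ∀ {i j} → 0ℤ ≤ℤ i → 0ℤ ≤ℤ j → 0ℤ ≤ℤ i +ℤ j
0≤i+j = ℤ.+-mono-≤

digits-periodic : ∀ a b c k n → digits a b c (suc (k ℕ.* 7 ℕ.+ n)) ≡ digits a b c (suc n)
digits-periodic a b c zero    n = refl
digits-periodic a b c (suc k) n = digits-periodic a b c k n

-- Inequalities between the digits

Conditions : ℤ → ℤ → ℤ → Set
Conditions a b c = b ≤ℤ -1ℤ × (1ℤ ≤ℤ c × c ≤ℤ -ℤ a) × a ≤ℤ + 2 *ℤ b ×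
  (a ≡ + 2 *ℤ b → 1ℤ ≤ℤ b +ℤ c)

module Digits (a b c : ℤ) (conditions : Conditions a b c) where

  private
    d : ℕ → ℤ
    d = digits a b c

    -- With the conditions stated as nonnegative differences, the digit inequalities below become
    -- sums of these, matched by the ring solver.
    0≤-1-b : 0ℤ ≤ℤ -1ℤ ℤ.- b
    0≤-1-b = ℤ.i≤j⇒0≤j-i (proj₁ conditions)

    0≤c-1 : 0ℤ ≤ℤ c ℤ.- 1ℤ
    0≤c-1 = ℤ.i≤j⇒0≤j-i (proj₁ (proj₁ (proj₂ conditions)))

    0≤-a-c : 0ℤ ≤ℤ -ℤ a ℤ.- c
    0≤-a-c = ℤ.i≤j⇒0≤j-i (proj₂ (proj₁ (proj₂ conditions)))

    0≤2b-a : 0ℤ ≤ℤ + 2 *ℤ b ℤ.- a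
    0≤2b-a = ℤ.i≤j⇒0≤j-i (proj₁ (proj₂ (proj₂ conditions)))

    0≤1 : 0ℤ ≤ℤ 1ℤ
    0≤1 = ℤ.+≤+ ℕ.z≤n

    0≤b-a : 0ℤ ≤ℤ b ℤ.- a
    0≤b-a = subst (0ℤ ≤ℤ_)
      (solveℤ 2 (λ a b → ((conℤ (+ 2) :*ℤ b :-ℤ a) :+ℤ (conℤ -1ℤ :-ℤ b)) :+ℤ conℤ 1ℤ :=ℤ b :-ℤ a) refl a b)
      (0≤i+j (0≤i+j 0≤2b-a 0≤-1-b) 0≤1)

    0≤j-[1+i]⇒i<j : ∀ {i j} → 0ℤ ≤ℤ j ℤ.- (1ℤ +ℤ i) → i ℤ.< j
    0≤j-[1+i]⇒i<j 0≤j-i-1 = ℤ.suc[i]≤j⇒i<j (ℤ.0≤i-j⇒j≤i 0≤j-i-1)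

  -- `d 7` - 1 = (2b - a) + 2(-1 - b). This positive digit provides the strict step within each
  -- period that makes the remainders positive.
  1≤d₇ : 1ℤ ≤ℤ d 7
  1≤d₇ = ℤ.0≤i-j⇒j≤i (subst (0ℤ ≤ℤ_)
    (solveℤ 2 (λ a b → ((conℤ (+ 2) :*ℤ b :-ℤ a) :+ℤ (conℤ -1ℤ :-ℤ b)) :+ℤ (conℤ -1ℤ :-ℤ b) :=ℤ
      :-ℤ (conℤ 1ℤ :+ℤ a) :-ℤ conℤ 1ℤ) refl a b)
    (0≤i+j (0≤i+j 0≤2b-a 0≤-1-b) 0≤-1-b))

  digits≥0 : ∀ n → 0ℤ ≤ℤ d n
  digits≥0 0 = subst (0ℤ ≤ℤ_)
    (solveℤ 2 (λ a c → ((:-ℤ a :-ℤ c) :+ℤ (c :-ℤ conℤ 1ℤ)) :+ℤ conℤ 1ℤ :=ℤ :-ℤ a) refl a c)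
    (0≤i+j (0≤i+j 0≤-a-c 0≤c-1) 0≤1)
  digits≥0 1 = subst (0ℤ ≤ℤ_)
    (solveℤ 1 (λ b → conℤ -1ℤ :-ℤ b :=ℤ :-ℤ (conℤ 1ℤ :+ℤ b)) refl b) 0≤-1-b
  digits≥0 2 = subst (0ℤ ≤ℤ_)
    (solveℤ 2 (λ a c → :-ℤ a :-ℤ c :=ℤ :-ℤ (a :+ℤ c)) refl a c) 0≤-a-c
  digits≥0 3 = subst (0ℤ ≤ℤ_)
    (solveℤ 1 (λ b → (((conℤ -1ℤ :-ℤ b) :+ℤ (conℤ -1ℤ :-ℤ b)) :+ℤ conℤ 1ℤ) :+ℤ conℤ 1ℤ :=ℤ :-ℤ (b :+ℤ b)) refl b)
    (0≤i+j (0≤i+j (0≤i+j 0≤-1-b 0≤-1-b) 0≤1) 0≤1)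
  digits≥0 4 = subst (0ℤ ≤ℤ_)
    (solveℤ 2 (λ a c → :-ℤ a :-ℤ c :=ℤ :-ℤ (c :+ℤ a)) refl a c) 0≤-a-c
  digits≥0 5 = digits≥0 1
  digits≥0 6 = ℤ.≤-trans 0≤1 1≤d₇
  digits≥0 7 = ℤ.≤-trans 0≤1 1≤d₇
  digits≥0 (suc (suc (suc (suc (suc (suc (suc (suc n)))))))) = digits≥0 (suc n)

  d₁<d₀ : d 1 ℤ.< d 0
  d₁<d₀ = 0≤j-[1+i]⇒i<j (subst (0ℤ ≤ℤ_)
    (solveℤ 2 (λ a b → b :-ℤ a :=ℤ :-ℤ a :-ℤ (conℤ 1ℤ :+ℤ :-ℤ (conℤ 1ℤ :+ℤ b))) refl a b) 0≤b-a)

  d₂<d₀ : d 2 ℤ.< d 0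
  d₂<d₀ = 0≤j-[1+i]⇒i<j (subst (0ℤ ≤ℤ_)
    (solveℤ 2 (λ a c → c :-ℤ conℤ 1ℤ :=ℤ :-ℤ a :-ℤ (conℤ 1ℤ :+ℤ :-ℤ (a :+ℤ c))) refl a c) 0≤c-1)

  d₃≤d₀ : d 3 ≤ℤ d 0
  d₃≤d₀ = ℤ.0≤i-j⇒j≤i (subst (0ℤ ≤ℤ_)
    (solveℤ 2 (λ a b → conℤ (+ 2) :*ℤ b :-ℤ a :=ℤ :-ℤ a :-ℤ :-ℤ (b :+ℤ b)) refl a b) 0≤2b-a)

  d₂≡d₄ : d 2 ≡ d 4
  d₂≡d₄ = cong -ℤ_ (ℤ.+-comm a c)

  d₄<d₀ : d 4 ℤ.< d 0
  d₄<d₀ = subst (ℤ._< d 0) d₂≡d₄ d₂<d₀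

  d₇<d₀ : d 7 ℤ.< d 0
  d₇<d₀ = 0≤j-[1+i]⇒i<j (subst (0ℤ ≤ℤ_)
    (solveℤ 1 (λ a → conℤ 0ℤ :=ℤ :-ℤ a :-ℤ (conℤ 1ℤ :+ℤ :-ℤ (conℤ 1ℤ :+ℤ a))) refl a) ℤ.≤-refl)

  -- `d 3` - `d 1` = 1 - b > 0. These two digits rule out every period shorter than 7.
  d₁≢d₃ : d 1 ≢ d 3
  d₁≢d₃ d₁≡d₃ = ℤ.<-irrefl d₁≡d₃ (0≤j-[1+i]⇒i<j (subst (0ℤ ≤ℤ_)
    (solveℤ 1 (λ b → conℤ -1ℤ :-ℤ b :+ℤ conℤ 1ℤ :=ℤ
      :-ℤ (b :+ℤ b) :-ℤ (conℤ 1ℤ :+ℤ :-ℤ (conℤ 1ℤ :+ℤ b))) refl b)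
    (0≤i+j 0≤-1-b 0≤1)))

  -- The tie means a = 2b, and then `d 1` - `d 4` = b + c - 1, which (iv) makes nonnegative.
  d₃≡d₀⇒d₄≤d₁ : d 3 ≡ d 0 → d 4 ≤ℤ d 1
  d₃≡d₀⇒d₄≤d₁ d₃≡d₀ = ℤ.0≤i-j⇒j≤i (subst (0ℤ ≤ℤ_)
    (trans
      (solveℤ 2 (λ b c → (b :+ℤ c) :-ℤ conℤ 1ℤ :=ℤ
        :-ℤ (conℤ 1ℤ :+ℤ b) :-ℤ :-ℤ (c :+ℤ conℤ (+ 2) :*ℤ b)) refl b c)
      (cong (λ i → -ℤ (1ℤ +ℤ b) ℤ.- (-ℤ (c +ℤ i))) (sym a≡2b)))
    (ℤ.i≤j⇒0≤j-i (proj₂ (proj₂ (proj₂ conditions)) a≡2b)))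
    where
    a≡2b : a ≡ + 2 *ℤ b
    a≡2b = trans (ℤ.neg-injective (sym d₃≡d₀))
      (solveℤ 1 (λ b → b :+ℤ b :=ℤ conℤ (+ 2) :*ℤ b) refl b)

  -- Index 3 is the one place in the period where the leading digit can recur. If `d 4` also ties
  -- with `d 1`, then `d 5` = `d 1` = `d 4` = `d 2`, and the comparison is settled by `d 6` = `d 7`
  -- < `d 0` = `d 3`.
  lex₃ : Lex d 0 3 4 ⊎ Lex d 0 3 5 ⊎ Lex d 0 3 7
  lex₃ with d 3 ℤ.≟ d 0 | d 4 ℤ.≟ d 1
  ... | no d₃≢d₀  | _         = inj₁ (here (ℤ.≤∧≢⇒< d₃≤d₀ d₃≢d₀))
  ... | yes d₃≡d₀ | no d₄≢d₁  = inj₂ (inj₁ (there d₃≡d₀ (here (ℤ.≤∧≢⇒< (d₃≡d₀⇒d₄≤d₁ d₃≡d₀) d₄≢d₁))))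
  ... | yes d₃≡d₀ | yes d₄≡d₁ = inj₂ (inj₂ (there d₃≡d₀ (there d₄≡d₁ (there (sym (trans d₂≡d₄ d₄≡d₁))
    (here (subst (d 6 ℤ.<_) (sym d₃≡d₀) d₇<d₀))))))

  private
    recurs : ∀ m′ p′ → EventuallyPeriodic d m′ p′ → ∀ k n → d (n ℕ.+ m′) ≡ d (k ℕ.* p′ ℕ.+ (n ℕ.+ m′))
    recurs m′ p′ periodic zero    n = refl
    recurs m′ p′ periodic (suc k) n = trans (recurs m′ p′ periodic k n) (trans
      (cong d (solveℕ 3 (λ q n m → q :+ℕ (n :+ℕ m) :=ℕ (q :+ℕ n) :+ℕ m) refl (k ℕ.* p′) n m′))
      (trans (periodic (k ℕ.* p′ ℕ.+ n))
        (cong d (solveℕ 4 (λ p q n m → (q :+ℕ n) :+ℕ m :+ℕ p :=ℕ (p :+ℕ q) :+ℕ (n :+ℕ m)) refl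
          p′ (k ℕ.* p′) n m′))))

    -- Far out in the sequence, k periods p′ shift the digit at 1 to the one at 3 modulo 7.
    d₁≡d₃ : ∀ m′ p′ k t → k ℕ.* p′ ≡ t ℕ.* 7 ℕ.+ 2 → EventuallyPeriodic d m′ p′ → d 1 ≡ d 3
    d₁≡d₃ m′ p′ k t kp′≡7t+2 periodic = begin
      d 1                                       ≡⟨ digits-periodic a b c m′ 0 ⟨
      d (suc (m′ ℕ.* 7 ℕ.+ 0))                  ≡⟨ cong d (solveℕ 1 (λ m → conℕ 1 :+ℕ (m :*ℕ conℕ 7 :+ℕ conℕ 0) :=ℕ
                                                     conℕ 1 :+ℕ m :*ℕ conℕ 6 :+ℕ m) refl m′) ⟩
      d (suc (m′ ℕ.* 6) ℕ.+ m′)                 ≡⟨ recurs m′ p′ periodic k (suc (m′ ℕ.* 6)) ⟩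
      d (k ℕ.* p′ ℕ.+ (suc (m′ ℕ.* 6) ℕ.+ m′))  ≡⟨ cong (λ q → d (q ℕ.+ (suc (m′ ℕ.* 6) ℕ.+ m′))) kp′≡7t+2 ⟩
      d (t ℕ.* 7 ℕ.+ 2 ℕ.+ (suc (m′ ℕ.* 6) ℕ.+ m′))
        ≡⟨ cong d (solveℕ 2 (λ m t → t :*ℕ conℕ 7 :+ℕ conℕ 2 :+ℕ (conℕ 1 :+ℕ m :*ℕ conℕ 6 :+ℕ m) :=ℕ
             conℕ 1 :+ℕ ((t :+ℕ m) :*ℕ conℕ 7 :+ℕ conℕ 2)) refl m′ t) ⟩
      d (suc ((t ℕ.+ m′) ℕ.* 7 ℕ.+ 2))          ≡⟨ digits-periodic a b c (t ℕ.+ m′) 2 ⟩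
      d 3                                       ∎
      where open ≡-Reasoning

    -- Seven periods shift index 0 to a positive multiple of 7, where the digit is `d 7`; so `d 0`
    -- would equal `d 7`.
    preperiod≢0 : ∀ p′ → 1 ℕ.≤ p′ → ¬ EventuallyPeriodic d 0 p′
    preperiod≢0 (suc q) _ periodic = ℤ.<-irrefl
      (trans (sym (digits-periodic a b c q 6))
        (trans (cong d (solveℕ 1 (λ q → conℕ 1 :+ℕ (q :*ℕ conℕ 7 :+ℕ conℕ 6) :=ℕ
            conℕ 7 :*ℕ (conℕ 1 :+ℕ q) :+ℕ conℕ 0) refl q))
          (sym (recurs 0 (suc q) periodic 7 0))))
      d₇<d₀

  digits-period-least : ∀ m′ p′ → 1 ℕ.≤ p′ → EventuallyPeriodic d m′ p′ → 1 ℕ.≤ m′ × 7 ℕ.≤ p′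
  digits-period-least zero p′ 1≤p′ periodic = ⊥-elim (preperiod≢0 p′ 1≤p′ periodic)
  digits-period-least m′@(suc _) p′ 1≤p′ periodic = ℕ.s≤s ℕ.z≤n , 7≤p′ p′ 1≤p′ periodic
    where
    7≤p′ : ∀ p′ → 1 ℕ.≤ p′ → EventuallyPeriodic d m′ p′ → 7 ℕ.≤ p′
    -- Every p′ from 1 to 6 is invertible modulo 7. The two numerals after p′ are k and t with k p′
    -- = 7t + 2, the shift from residue 1 to residue 3.
    7≤p′ 1 _ periodic = ⊥-elim (d₁≢d₃ (d₁≡d₃ m′ 1 2 0 refl periodic))
    7≤p′ 2 _ periodic = ⊥-elim (d₁≢d₃ (d₁≡d₃ m′ 2 1 0 refl periodic))
    7≤p′ 3 _ periodic = ⊥-elim (d₁≢d₃ (d₁≡d₃ m′ 3 3 1 refl periodic))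
    7≤p′ 4 _ periodic = ⊥-elim (d₁≢d₃ (d₁≡d₃ m′ 4 4 2 refl periodic))
    7≤p′ 5 _ periodic = ⊥-elim (d₁≢d₃ (d₁≡d₃ m′ 5 6 4 refl periodic))
    7≤p′ 6 _ periodic = ⊥-elim (d₁≢d₃ (d₁≡d₃ m′ 6 5 4 refl periodic))
    7≤p′ (suc (suc (suc (suc (suc (suc (suc q))))))) _ _ = ℕ.m≤m+n 7 q

-- Sufficiency: the remainders lie strictly between 0 and 1

module Expansion (β : ℝ) (a b c : ℤ) (1<β : 1ℝ < β)
  (root : evalℚ (ℤ[x]⇒ℚ[x] (sextic a b c)) β ≈ 0ℝ) (conditions : Conditions a b c) where

  open Digits a b c conditions

  private
    d : ℕ → ℤ
    d = digits a b c

    r : ℕ → ℝ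
    r = remainder β d

    r-periodic : ∀ n → r (8 ℕ.+ n) ≈ r (1 ℕ.+ n)
    r-periodic = remainder-periodic β a b c 1<β root

    -- `d 7` ≥ 1 gives `r 7 ⊏ r 8`; six steps with nonnegative digits extend this to `r 14`, which
    -- equals `r 7`.
    r₇>0 : 0ℝ < r 7
    r₇>0 = ⊏-self⇒0< (r 7) (⊏-≥-trans (r 7) (r 14) (r 7)
      (⊏-remainder β 1<β d digits≥0 (r 7) 6 8 (remainder-step-⊏ β 1<β d 7 1≤d₇))
      (≈⇒≤ (r 7) (r 14) (≈-sym (r 14) (r 7) (r-periodic 6))))

    r₇₊₇ₖ>0 : ∀ k → 0ℝ < r (suc (k ℕ.* 7 ℕ.+ 6))
    r₇₊₇ₖ>0 zero    = r₇>0
    r₇₊₇ₖ>0 (suc k) = <-≤-trans 0ℝ (r (suc i)) (r (8 ℕ.+ i)) (r₇₊₇ₖ>0 k)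
      (≈⇒≤ (r (suc i)) (r (8 ℕ.+ i)) (≈-sym (r (8 ℕ.+ i)) (r (suc i)) (r-periodic i)))
      where i = k ℕ.* 7 ℕ.+ 6

  r>0 : ∀ n → 0ℝ < r n
  -- `N` = 7n + 7 is a multiple of 7 beyond `n`; positivity there is carried back to `n`.
  r>0 n = remainder-pos-back β 1<β d digits≥0 (N ℕ.∸ n) n
    (subst (λ m → 0ℝ < r m) (sym (ℕ.m∸n+n≡m n≤N)) (r₇₊₇ₖ>0 n))
    where
    N = suc (n ℕ.* 7 ℕ.+ 6)
    n≤N : n ℕ.≤ N
    n≤N = ℕ.m≤n⇒m≤1+n (ℕ.m≤n⇒m≤n+o 6 (ℕ.m≤m*n n 7))

  private
    gap : ℕ → ℝ
    gap n = 1ℝ - r n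

    -- Positivity of the remainders comes first because `remainder-gap` relies on it.
    jump : ∀ n m → Lex d 0 n m → gap n ⊏ gap m
    jump n m = remainder-gap β 1<β d (λ n → r>0 (suc n)) {0} {n} {m}

    via : ∀ n m → gap m ⊏ gap 8 → Lex d 0 n m → gap n ⊏ gap 8
    via n m g lex = ⊏-trans (gap n) (gap m) (gap 8) (jump n m lex) g

    gap₈-gap₁ : ∀ n → gap (8 ℕ.+ n) ≈ gap (1 ℕ.+ n)
    gap₈-gap₁ n = ≈-shift (r (1 ℕ.+ n)) (r (8 ℕ.+ n)) (gap (8 ℕ.+ n)) (gap (1 ℕ.+ n))
      (λ m → solve 2 (λ u v → u :- v := (con 1ℚ :- v) :- (con 1ℚ :- u)) refl
        (seq (r (1 ℕ.+ n)) m) (seq (r (8 ℕ.+ n)) m))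
      (≈-sym (r (8 ℕ.+ n)) (r (1 ℕ.+ n)) (r-periodic n))

    -- Built downwards from 7: each index jumps to a later one already joined to 8. All jumps have
    -- length 1 except possibly the one from 3. `gap 8` equals `gap 1`, so `g₁` closes the cycle.
    g₇ : gap 7 ⊏ gap 8
    g₇ = jump 7 8 (here d₇<d₀)
    g₆ : gap 6 ⊏ gap 8
    g₆ = via 6 7 g₇ (here d₇<d₀)
    g₅ : gap 5 ⊏ gap 8
    g₅ = via 5 6 g₆ (here d₁<d₀)
    g₄ : gap 4 ⊏ gap 8
    g₄ = via 4 5 g₅ (here d₄<d₀)
    g₃ : gap 3 ⊏ gap 8
    g₃ = [ via 3 4 g₄ , [ via 3 5 g₅ , via 3 7 g₇ ]′ ]′ lex₃
    g₂ : gap 2 ⊏ gap 8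
    g₂ = via 2 3 g₃ (here d₂<d₀)
    g₁ : gap 1 ⊏ gap 8
    g₁ = via 1 2 g₂ (here d₁<d₀)

    gap₁>0 : 0ℝ < gap 1
    gap₁>0 = ⊏-self⇒0< (gap 1) (⊏-≥-trans (gap 1) (gap 8) (gap 1) g₁
      (≈⇒≤ (gap 1) (gap 8) (≈-sym (gap 8) (gap 1) (gap₈-gap₁ 0))))

    gap-periodic : ∀ n → 0ℝ < gap (1 ℕ.+ n) → 0ℝ < gap (8 ℕ.+ n)
    gap-periodic n 0<gap = <-≤-trans 0ℝ (gap (1 ℕ.+ n)) (gap (8 ℕ.+ n)) 0<gap
      (≈⇒≤ (gap (1 ℕ.+ n)) (gap (8 ℕ.+ n)) (≈-sym (gap (8 ℕ.+ n)) (gap (1 ℕ.+ n)) (gap₈-gap₁ n)))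

    before-8 : ∀ n → gap n ⊏ gap 8 → 0ℝ < gap n
    before-8 n g = ⊏⇒0< (gap n) (gap 8) g (<⇒≤ 0ℝ (gap 8) (gap-periodic 0 gap₁>0))

    gap>0 : ∀ n → 0ℝ < gap (suc n)
    gap>0 0 = gap₁>0
    gap>0 1 = before-8 2 g₂
    gap>0 2 = before-8 3 g₃
    gap>0 3 = before-8 4 g₄
    gap>0 4 = before-8 5 g₅
    gap>0 5 = before-8 6 g₆
    gap>0 6 = before-8 7 g₇
    gap>0 (suc (suc (suc (suc (suc (suc (suc n))))))) = gap-periodic n (gap>0 n)

  r<1 : ∀ n → r (suc n) < 1ℝ
  r<1 n = <-shift 0ℝ (gap (suc n)) (r (suc n)) 1ℝ
    (λ m → solve 1 (λ u → (con 1ℚ :- u) :- con 0ℚ := con 1ℚ :- u) refl (seq (r (suc n)) m))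
    (gap>0 n)

  parryExpansion : ParryExpansion β d 1 7
  parryExpansion = record
    { greedy         = remainders⇒greedy β d (λ n → <⇒≤ 0ℝ (r (suc n)) (r>0 (suc n))) r<1
    ; nonterminating = λ n rₙ≈0 → <-irrefl 0ℝ (<-≤-trans 0ℝ (r n) 0ℝ (r>0 n) (≈⇒≤ (r n) 0ℝ rₙ≈0))
    ; p≥1            = ℕ.s≤s ℕ.z≤n
    -- The indices are rewritten to `1 + n` and `8 + n`, where the last clause of `digits` applies.
    ; periodic       = λ n → trans (cong d (ℕ.+-comm n 1))
        (sym (cong d (trans (cong (ℕ._+ 7) (ℕ.+-comm n 1)) (ℕ.+-comm (suc n) 7))))
    ; least          = digits-period-least
    }

-- Necessity: constraints on greedy digits

conditions-necessary : ∀ β a b c d → 1ℝ < β → IsGreedyExpansion β d →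
  companionPolynomial d 1 7 ≋ sextic a b c ⊗ x²+1 → Conditions a b c
conditions-necessary β a b c d 1<β greedy factorisation =
  b≤-1 , (1≤c , c≤-a) , a≤2b , 1≤b+c
  where
  0<β = 1<z⇒0<z β 1<β
  r = remainder β d
  known = digits-determined a b c d factorisation
  d₀≡ = proj₁ known
  d₁≡ = proj₁ (proj₂ known)
  d₂≡ = proj₁ (proj₂ (proj₂ known))
  d₃≡ = proj₁ (proj₂ (proj₂ (proj₂ known)))
  d₄≡ = proj₂ (proj₂ (proj₂ (proj₂ known)))

  -- r_{n+1} < 1 = r_0, and a smaller remainder has no larger digit.
  digit≤d₀ : ∀ n → d (suc n) ≤ℤ d 0
  digit≤d₀ n = greedy-mono β 0<β d greedy (suc n) 0 (remainder<1 β d greedy n)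

  tie⇒next≤d₁ : ∀ n → d (suc n) ≡ d 0 → d (suc (suc n)) ≤ℤ d 1
  tie⇒next≤d₁ n tie = greedy-mono β 0<β d greedy (suc (suc n)) 1
    (remainder-< β 0<β d (suc n) 0 tie (remainder<1 β d greedy n))

  b≤-1 : b ≤ℤ -1ℤ
  b≤-1 = ℤ.0≤i-j⇒j≤i (subst (0ℤ ≤ℤ_)
    (trans d₁≡ (solveℤ 1 (λ b → :-ℤ (conℤ 1ℤ :+ℤ b) :=ℤ conℤ -1ℤ :-ℤ b) refl b))
    (greedy-digit≥0 β 0<β d greedy 1))

  c≤-a : c ≤ℤ -ℤ a
  c≤-a = ℤ.0≤i-j⇒j≤i (subst (0ℤ ≤ℤ_)
    (trans d₂≡ (solveℤ 2 (λ a c → :-ℤ (a :+ℤ c) :=ℤ :-ℤ a :-ℤ c) refl a c))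
    (greedy-digit≥0 β 0<β d greedy 2))

  a≤2b : a ≤ℤ + 2 *ℤ b
  a≤2b = ℤ.0≤i-j⇒j≤i (subst (0ℤ ≤ℤ_)
    (trans (cong₂ ℤ._-_ d₀≡ d₃≡)
      (solveℤ 2 (λ a b → :-ℤ a :-ℤ :-ℤ (b :+ℤ b) :=ℤ conℤ (+ 2) :*ℤ b :-ℤ a) refl a b))
    (ℤ.i≤j⇒0≤j-i (digit≤d₀ 2)))

  0≤c : 0ℤ ≤ℤ c
  0≤c = subst (0ℤ ≤ℤ_)
    (trans (cong₂ ℤ._-_ d₀≡ d₂≡)
      (solveℤ 2 (λ a c → :-ℤ a :-ℤ :-ℤ (a :+ℤ c) :=ℤ c) refl a c))
    (ℤ.i≤j⇒0≤j-i (digit≤d₀ 1))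

  -- If c = 0 then `d 2` = `d 0`, so `d 3` ≤ `d 1`, that is -2b ≤ -1 - b. This gives b ≥ 1, against
  -- b ≤ -1.
  c≢0 : 0ℤ ≢ c
  c≢0 0≡c = ℤ.<⇒≱ ℤ.-<+ (ℤ.≤-trans (ℤ.0≤i-j⇒j≤i 1≤b) b≤-1)
    where
    d₂≡d₀ : d 2 ≡ d 0
    d₂≡d₀ = trans d₂≡ (trans (cong (λ i → -ℤ (a +ℤ i)) (sym 0≡c))
      (trans (cong -ℤ_ (ℤ.+-identityʳ a)) (sym d₀≡)))
    1≤b : 0ℤ ≤ℤ b ℤ.- 1ℤ
    1≤b = subst (0ℤ ≤ℤ_)
      (trans (cong₂ ℤ._-_ d₁≡ d₃≡)
        (solveℤ 1 (λ b → :-ℤ (conℤ 1ℤ :+ℤ b) :-ℤ :-ℤ (b :+ℤ b) :=ℤ b :-ℤ conℤ 1ℤ) refl b))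
      (ℤ.i≤j⇒0≤j-i (tie⇒next≤d₁ 1 d₂≡d₀))

  1≤c : 1ℤ ≤ℤ c
  1≤c = ℤ.i<j⇒suc[i]≤j (ℤ.≤∧≢⇒< 0≤c c≢0)

  1≤b+c : a ≡ + 2 *ℤ b → 1ℤ ≤ℤ b +ℤ c
  -- a = 2b is the tie `d 3` = `d 0`; the resulting `d 4` ≤ `d 1` reads b + c - 1 ≥ 0.
  1≤b+c a≡2b = ℤ.0≤i-j⇒j≤i (subst (0ℤ ≤ℤ_)
    (trans (cong₂ ℤ._-_ d₁≡ (trans d₄≡ (cong (λ i → -ℤ (c +ℤ i)) a≡2b)))
      (solveℤ 2 (λ b c → :-ℤ (conℤ 1ℤ :+ℤ b) :-ℤ :-ℤ (c :+ℤ conℤ (+ 2) :*ℤ b) :=ℤ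
        (b :+ℤ c) :-ℤ conℤ 1ℤ) refl b c))
    (ℤ.i≤j⇒0≤j-i (tie⇒next≤d₁ 2 d₃≡d₀)))
    where
    d₃≡d₀ : d 3 ≡ d 0
    d₃≡d₀ = trans d₃≡ (trans
      (solveℤ 1 (λ b → :-ℤ (b :+ℤ b) :=ℤ :-ℤ (conℤ (+ 2) :*ℤ b)) refl b)
      (trans (cong -ℤ_ (sym a≡2b)) (sym d₀≡)))

-- Both expansions have the same digits, so the preperiod and period of each are admissible for the
-- other, and leastness applies both ways.
parry-unique : ∀ β {c d m p m′ p′} → 0ℝ < β →
  ParryExpansion β c m p → ParryExpansion β d m′ p′ → m ≡ m′ × p ≡ p′
parry-unique β {c} {d} {m} {p} {m′} {p′} 0<β P Q =
  ℕ.≤-antisym (proj₁ P≤Q) (proj₁ Q≤P) , ℕ.≤-antisym (proj₂ P≤Q) (proj₂ Q≤P)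
  where
  module P = ParryExpansion P
  module Q = ParryExpansion Q
  agree : ∀ n → c n ≡ d n
  agree = greedy-unique β 0<β c d P.greedy Q.greedy
  P≤Q = P.least m′ p′ Q.p≥1 λ n → trans (agree _) (trans (Q.periodic n) (sym (agree _)))
  Q≤P = Q.least m p P.p≥1 λ n → trans (sym (agree _)) (trans (P.periodic n) (agree _))

-- HasCofactor carries its own expansion, (m , p) and minimal polynomial, which
-- are identified with d, (1 , 7) and the sextic by uniqueness.
cofactor⇒conditions : ∀ β a b c → 1ℝ < β →
  IsMinimalPolynomial β (ℤ[x]⇒ℚ[x] (sextic a b c)) →
  ∀ {d} → ParryExpansion β d 1 7 → HasCofactor β x²+1 → Conditions a b c
cofactor⇒conditions β a b c 1<β isMin parry₁₇ cofactor =
  conditions-necessary β a b c d 1<β (ParryExpansion.greedy parry) λ n → begin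
  ℤ[x].coeff (companionPolynomial d 1 7) n              ≡⟨ companion₁₇ n ⟩
  ℤ[x].coeff (M ⊗ x²+1) n                               ≡⟨ coeff-⊗-x²+1 M n ⟩
  ℤ[x].coeff M n +ℤ ℤ[x].coeff (0ℤ ∷ 0ℤ ∷ M) n          ≡⟨ cong₂ _+ℤ_ (M≋P n) (shifted n) ⟩
  ℤ[x].coeff P n +ℤ ℤ[x].coeff (0ℤ ∷ 0ℤ ∷ P) n          ≡⟨ coeff-⊗-x²+1 P n ⟨
  ℤ[x].coeff (P ⊗ x²+1) n                               ∎
  where
  open ≡-Reasoning
  open HasCofactor cofactor using (parry; factorisation) renaming (c to d; m to k; p to l; minPoly to M; isMinPoly to isM)
  P = sextic a b c
  k,l = parry-unique β (1<z⇒0<z β 1<β) parry₁₇ parry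
  companion₁₇ : companionPolynomial d 1 7 ≋ M ⊗ x²+1
  companion₁₇ = subst₂ (λ m p → companionPolynomial d m p ≋ M ⊗ x²+1)
    (sym (proj₁ k,l)) (sym (proj₂ k,l)) factorisation
  M≋P : M ≋ P
  M≋P = minimalPolynomialℤ-unique β M P isM isMin
  shifted : ∀ n → ℤ[x].coeff (0ℤ ∷ 0ℤ ∷ M) n ≡ ℤ[x].coeff (0ℤ ∷ 0ℤ ∷ P) n
  shifted zero          = refl
  shifted (suc zero)    = refl
  shifted (suc (suc n)) = M≋P n

proposition2p3 : ∀ (β : ℝ) (a b c : ℤ) →
    IsSalem β →
    IsMinimalPolynomial β (ℤ[x]⇒ℚ[x] (1ℤ ∷ a ∷ b ∷ c ∷ b ∷ a ∷ 1ℤ ∷ [])) →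
    β ∈ P⟨ 1 , 7 ⟩ ∩ C⟨ 1ℤ ∷ 0ℤ ∷ 1ℤ ∷ [] ⟩
    ⇔
    ( b ≤ℤ -1ℤ
    × (1ℤ ≤ℤ c × c ≤ℤ -ℤ a)
    × a ≤ℤ + 2 *ℤ b
    × (a ≡ + 2 *ℤ b → 1ℤ ≤ℤ b +ℤ c))
proposition2p3 β a b c salem isMin = mk⇔
  (λ ((_ , _ , parry) , _ , cofactor) → cofactor⇒conditions β a b c 1<β isMin parry cofactor)
  (λ conditions →
    let parry = Expansion.parryExpansion β a b c 1<β (IsMinimalPolynomial.root isMin) conditions
    in (salem , digits a b c , parry) , salem , record
      { c = digits a b c ; m = 1 ; p = 7 ; parry = parry
      ; minPoly = sextic a b c ; isMinPoly = isMin
      ; factorisation = companion-digits a b c })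
  where 1<β = IsSalem.1<β salem
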